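{- Let $a,b$ be integers with $a>b+1$ and $b>4$. Then the mountain-valley assignment $M^aV^b$ on the $1\times(a+b+1)$ strip of stamps has exactly $ab+b^2-b+1$ valid layer orderings, i.e. $c(M^aV^b)=ab+b^2-b+1$.
   Context: A $1\times n$ strip of stamps has faces labeled $0,1,\dots,n-1$ from left to right and $n-1$ creases, the crease $(i,i+1)$ lying between faces $i$ and $i+1$. A mountain-valley (MV) assignment is a map $\mu$ from the creases to $\{M,V\}$, written as the word $\mu((0,1))\mu((1,2))\cdots\mu((n-2,n-1))$; $S^k$ denotes the word $S$ repeated $k$ times, so $M^aV^b$ assigns $M$ to the first $a$ creases and $V$ to the last $b$. A permutation $\sigma$ of $\{0,\dots,n-1\}$ ($\sigma(i)$ = position of face $i$ in the folded stack, left to right) is a valid layer ordering for $\mu$ if: (1) for each crease $(i,i+1)$, if $\mu((i,i+1))=M$ and $i$ is even, or $\mu((i,i+1))=V$ and $i$ is odd, then $\sigma(i)>\sigma(i+1)$; otherwise $\sigma(i)<\sigma(i+1)$; (2) for any two creases $(i,i+1),(j,j+1)$ with $i\equiv j\pmod 2$, it is not the case that $\sigma(i)<\sigma(j)<\sigma(i+1)<\sigma(j+1)$, nor that this chain holds for any cyclic rotation of the sequence $(\sigma(i),\sigma(j),\sigma(i+1),\sigma(j+1))$. $c(\mu)$ denotes the number of valid layer orderings for $\mu$. -}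

module Defs where

open import Data.Nat using (ℕ; zero; suc)
open import Data.Bool using (Bool; true; false; if_then_else_)
import Data.Bool.Properties as BoolP
open import Data.Fin using (Fin; toℕ; inject₁; _<_; _<?_)
open import Data.Fin.Properties using (all?; _≟_)
open import Data.Vec using (Vec; []; _∷_; lookup)
open import Data.List using (List; []; _∷_; [_]; concatMap; map; filter; length; allFin)
open import Data.Product using (_×_)
open import Data.Sum using (_⊎_)
open import Relation.Binary.PropositionalEquality using (_≡_)
open import Relation.Nullary using (¬_; Dec; yes; no; ¬?)
open import Relation.Nullary.Decidable using (_×-dec_; _⊎-dec_; _→-dec_)

data MV : Set where
  M V : MV

-- A 1 × (suc m) strip has faces Fin (suc m) and m creases; crease i : Fin m
-- is the crease (i, i+1) between faces  inject₁ i  and  suc i.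
-- An MV assignment is a function on the creases.
Assignment : ℕ → Set
Assignment m = Fin m → MV

MᵃVᵇ : (a b : ℕ) → Assignment (a Data.Nat.+ b)
MᵃVᵇ a b i with toℕ i Data.Nat.<? a
... | yes _ = M
... | no  _ = V

isEven : ℕ → Bool
isEven zero = true
isEven (suc n) = Data.Bool.not (isEven n)

descends : MV → ℕ → Bool
descends M i = isEven i
descends V i = Data.Bool.not (isEven i)

-- A candidate layer ordering: σ as the vector of positions, σ(i) = lookup σ i.
Ordering : ℕ → Set
Ordering m = Vec (Fin (suc m)) (suc m)

IsPerm : ∀ {m} → Ordering m → Set
IsPerm {m} σ = ∀ (i j : Fin (suc m)) → lookup σ i ≡ lookup σ j → i ≡ j

Cond1 : ∀ {m} → Assignment m → Ordering m → Fin m → Set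
Cond1 μ σ i =
  if descends (μ i) (toℕ i)
  then lookup σ (Data.Fin.suc i) < lookup σ (inject₁ i)
  else lookup σ (inject₁ i) < lookup σ (Data.Fin.suc i)

Chain : ∀ {n} → Fin n → Fin n → Fin n → Fin n → Set
Chain p q r s = p < q × q < r × r < s

CyclicChain : ∀ {n} → Fin n → Fin n → Fin n → Fin n → Set
CyclicChain p q r s =
  Chain p q r s ⊎ Chain q r s p ⊎ Chain r s p q ⊎ Chain s p q r

Cond2 : ∀ {m} → Ordering m → Fin m → Fin m → Set
Cond2 σ i j =
  isEven (toℕ i) ≡ isEven (toℕ j) →
  ¬ CyclicChain (lookup σ (inject₁ i)) (lookup σ (inject₁ j))
                (lookup σ (Data.Fin.suc i)) (lookup σ (Data.Fin.suc j))

ValidOrdering : ∀ {m} → Assignment m → Ordering m → Set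
ValidOrdering μ σ =
  IsPerm σ × (∀ i → Cond1 μ σ i) × (∀ i j → Cond2 σ i j)

chain? : ∀ {n} (p q r s : Fin n) → Dec (Chain p q r s)
chain? p q r s = (p <? q) ×-dec (q <? r) ×-dec (r <? s)

cyclicChain? : ∀ {n} (p q r s : Fin n) → Dec (CyclicChain p q r s)
cyclicChain? p q r s =
  chain? p q r s ⊎-dec chain? q r s p ⊎-dec chain? r s p q ⊎-dec chain? s p q r

cond1? : ∀ {m} (μ : Assignment m) (σ : Ordering m) (i : Fin m) → Dec (Cond1 μ σ i)
cond1? μ σ i with descends (μ i) (toℕ i)
... | true  = lookup σ (Data.Fin.suc i) <? lookup σ (inject₁ i)
... | false = lookup σ (inject₁ i) <? lookup σ (Data.Fin.suc i)

cond2? : ∀ {m} (σ : Ordering m) (i j : Fin m) → Dec (Cond2 σ i j)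
cond2? σ i j =
  (isEven (toℕ i) BoolP.≟ isEven (toℕ j)) →-dec
  ¬? (cyclicChain? _ _ _ _)

isPerm? : ∀ {m} (σ : Ordering m) → Dec (IsPerm σ)
isPerm? σ = all? λ i → all? λ j → (lookup σ i ≟ lookup σ j) →-dec (i ≟ j)

validOrdering? : ∀ {m} (μ : Assignment m) (σ : Ordering m) → Dec (ValidOrdering μ σ)
validOrdering? μ σ =
  isPerm? σ ×-dec all? (cond1? μ σ) ×-dec all? (λ i → all? (cond2? σ i))

allVecs : ∀ {n} (k : ℕ) → List (Vec (Fin n) k)
allVecs zero = [ [] ]
allVecs {n} (suc k) = concatMap (λ x → map (x ∷_) (allVecs k)) (allFin n)

c : ∀ {m} → Assignment m → ℕ
c {m} μ = length (filter (validOrdering? μ) (allVecs (suc m)))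

{-# OPTIONS --safe #-}
module Submission where

-- Build a folded stack one face at a time.  The new face e + 1 may jump over an initial segment of
-- the faces on the side prescribed by the crease exactly when that segment is closed under the
-- creases of the same parity.  As long as the slope of the creases does not change, the prescribed
-- side alternates, so a partial stack is best seen from its last face as a pair of lists (near side,
-- far side), and a jump over seg turns (seg ++ rest, Q) into (seg ʳ++ e ∷ Q, rest).  Stopping before
-- the first face of the near side traps all later faces in a coil, which can be completed in one way
-- only.  The faces of M^a roll up outwards k times and then inwards; those of V^b have to travel back
-- through the corridor formed by the inward roll, and after it either around the outward roll or into
-- it.  At every step the only alternative is to coil up, so the orderings are counted by linear
-- recursions.  The bound a > b + 1 ensures that V^b never reaches the centre of the outward roll.

open import Defs
open import Data.Bool using (Bool; true; false; not; if_then_else_)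
open import Data.Bool.Properties using (not-involutive; not-¬)
open import Data.Empty using (⊥)
open import Data.Fin as Fin using (Fin; toℕ; fromℕ<; inject₁)
open import Data.Fin.Properties using (toℕ<n; toℕ-fromℕ<; fromℕ<-toℕ; toℕ-injective; toℕ-inject₁)
open import Data.List
  using (List; []; _∷_; [_]; _++_; _ʳ++_; _∷ʳ_; length; map; reverse; concatMap; cartesianProductWith; allFin; downFrom)
open import Data.List.Membership.Propositional using (_∈_)
open import Data.List.Membership.Propositional.Properties
  using (∈-++⁺ˡ; ∈-++⁺ʳ; ∈-++⁻; ∈-filter⁺; ∈-filter⁻; ∈-allFin; ∈-cartesianProductWith⁺; ∈-downFrom⁺; ∈-downFrom⁻)
open import Data.List.Membership.Propositional.Properties.WithK using (unique∧set⇒bag)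
open import Data.List.Properties using (length-++; length-downFrom; ++-assoc; ++-identityʳ; ʳ++-defn; ++-ʳ++)
open import Data.List.Relation.Binary.BagAndSetEquality using (∼bag⇒↭)
open import Data.List.Relation.Binary.Permutation.Propositional
  using (_↭_; ↭⇒↭ₛ; ↭-refl; ↭-trans; ↭-sym; ↭-prep; module PermutationReasoning)
open import Data.List.Relation.Binary.Permutation.Propositional.Properties
  using (↭-length; ∈-resp-↭; ++↭ʳ++; ++-comm; shift; ++⁺ʳ; ++⁺ˡ)
import Data.List.Relation.Binary.Permutation.Setoid.Properties as PermutationS
open import Data.List.Relation.Unary.All as All using (All; []; _∷_)
import Data.List.Relation.Unary.All.Properties as All
open import Data.List.Relation.Unary.AllPairs as AllPairs using (AllPairs; []; _∷_)
import Data.List.Relation.Unary.AllPairs.Properties as AllPairs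
open import Data.List.Relation.Unary.Any using (here; there)
open import Data.List.Relation.Unary.Unique.Propositional using (Unique)
import Data.List.Relation.Unary.Unique.Propositional.Properties as Unique
open import Data.Nat using (ℕ; zero; suc; _+_; _*_; _∸_; _≤_; _<_; z≤n; s≤s; s≤s⁻¹; _<?_; _≟_)
open import Data.Nat.Properties hiding (_<?_; _≟_)
open import Data.Nat.Tactic.RingSolver using (solve-∀)
open import Data.Product using (∃; _×_; _,_; proj₁; proj₂; swap)
open import Data.Sum using (_⊎_; inj₁; inj₂; [_,_]′)
open import Data.Vec as Vec using (Vec; []; _∷_; lookup)
open import Data.Vec.Properties using (∷-injective; lookup∘tabulate)
open import Data.Vec.Relation.Binary.Pointwise.Extensional using (ext; Pointwise-≡⇒≡)
open import Function using (_∘_; flip; _on_; mk⇔)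
open import Relation.Binary.Definitions using (Transitive; tri<; tri≈; tri>)
open import Relation.Binary.PropositionalEquality using (_≡_; _≢_; refl; sym; trans; cong; cong₂; subst; subst₂)
open import Relation.Binary.PropositionalEquality.Properties using (setoid)
open import Relation.Nullary using (¬_; yes; no; contradiction)

-- Counting by duplicate-free lists.

record Card {A : Set} (P : A → Set) (n : ℕ) : Set where
  constructor card
  field
    members  : List A
    unique   : Unique members
    size     : length members ≡ n
    sound    : ∀ {x} → x ∈ members → P x
    complete : ∀ {x} → P x → x ∈ members


Card-⊎ : ∀ {A : Set} {P Q R : A → Set} {k l} →
  (∀ {x} → R x → P x ⊎ Q x) → (∀ {x} → P x → R x) → (∀ {x} → Q x → R x) →
  (∀ {x} → P x → Q x → ⊥) → Card P k → Card Q l → Card R (k + l)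
Card-⊎ split inP inQ disj (card xs xs! refl xs⊨ ⊨xs) (card ys ys! refl ys⊨ ⊨ys) = card
  (xs ++ ys)
  (Unique.++⁺ xs! ys! λ (x∈xs , x∈ys) → disj (xs⊨ x∈xs) (ys⊨ x∈ys))
  (length-++ xs)
  (λ x∈ → [ inP ∘ xs⊨ , inQ ∘ ys⊨ ]′ (∈-++⁻ xs x∈))
  (λ r → [ ∈-++⁺ˡ ∘ ⊨xs , ∈-++⁺ʳ xs ∘ ⊨ys ]′ (split r))

Card-cong : ∀ {A : Set} {P Q : A → Set} {n} →
  (∀ {x} → P x → Q x) → (∀ {x} → Q x → P x) → Card P n → Card Q n
Card-cong f g (card xs xs! eq xs⊨ ⊨xs) = card xs xs! eq (f ∘ xs⊨) (⊨xs ∘ g)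

Card-singleton : ∀ {A : Set} {P : A → Set} (x : A) → P x → (∀ {y} → P y → y ≡ x) → Card P 1
Card-singleton x Px only = card [ x ] ([] ∷ []) refl (λ { (here refl) → Px }) (λ Py → here (only Py))

allVecs-product : ∀ {A B C : Set} (f : A → B → C) xs ys →
  concatMap (λ x → map (f x) ys) xs ≡ cartesianProductWith f xs ys
allVecs-product f []       ys = refl
allVecs-product f (x ∷ xs) ys = cong (map (f x) ys ++_) (allVecs-product f xs ys)

allVecs-unique : ∀ {n} k → Unique (allVecs {n} k)
allVecs-unique zero    = [] ∷ []
allVecs-unique {n} (suc k) = subst Unique (sym (allVecs-product _∷_ (allFin n) (allVecs k)))
  (Unique.cartesianProductWith⁺ _∷_ ∷-injective (Unique.allFin⁺ n) (allVecs-unique k))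

∈-allVecs : ∀ {n k} (v : Vec (Fin n) k) → v ∈ allVecs k
∈-allVecs []      = here refl
∈-allVecs {n} {suc k} (x ∷ v) = subst ((x ∷ v) ∈_) (sym (allVecs-product _∷_ (allFin n) (allVecs k)))
  (∈-cartesianProductWith⁺ _∷_ (∈-allFin x) (∈-allVecs v))

-- Duplicate-free lists with the same members are permutations of each other, so any such list of
-- the valid orderings is as long as the filtered enumeration in `c`.
c-Card : ∀ {m} {μ : Assignment m} {n} → Card (ValidOrdering μ) n → c μ ≡ n
c-Card {m} {μ} (card xs xs! refl xs⊨ ⊨xs) = ↭-length (∼bag⇒↭ (unique∧set⇒bag
  (Unique.filter⁺ (validOrdering? μ) (allVecs-unique (suc m))) xs!
  (mk⇔ (⊨xs ∘ proj₂ ∘ ∈-filter⁻ (validOrdering? μ) {xs = allVecs (suc m)})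
       (∈-filter⁺ (validOrdering? μ) (∈-allVecs _) ∘ xs⊨))))

-- Sorted lists and ranks.

AllPairs-total : ∀ {A : Set} {R : A → A → Set} {xs x y} → AllPairs R xs → x ∈ xs → y ∈ xs →
  x ≡ y ⊎ R x y ⊎ R y x
AllPairs-total (Rx ∷ Rxs) (here refl) (here refl) = inj₁ refl
AllPairs-total (Rx ∷ Rxs) (here refl) (there y∈)  = inj₂ (inj₁ (All.lookup Rx y∈))
AllPairs-total (Rx ∷ Rxs) (there x∈)  (here refl) = inj₂ (inj₂ (All.lookup Rx x∈))
AllPairs-total (Rx ∷ Rxs) (there x∈)  (there y∈)  = AllPairs-total Rxs x∈ y∈

AllPairs-++⁻ : ∀ {A : Set} {R : A → A → Set} xs {ys} → AllPairs R (xs ++ ys) →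
  AllPairs R xs × AllPairs R ys × (∀ {x y} → x ∈ xs → y ∈ ys → R x y)
AllPairs-++⁻ []       Rys = [] , Rys , λ ()
AllPairs-++⁻ (x ∷ xs) (Rx ∷ Rxsys) with AllPairs-++⁻ xs Rxsys
... | Rxs , Rys , Rxy = All.++⁻ˡ xs Rx ∷ Rxs , Rys , λ
  { (here refl) y∈ → All.lookup (All.++⁻ʳ xs Rx) y∈ ; (there x∈) y∈ → Rxy x∈ y∈ }

AllPairs-++⁺ : ∀ {A : Set} {R : A → A → Set} {xs ys} → AllPairs R xs → AllPairs R ys →
  (∀ {x y} → x ∈ xs → y ∈ ys → R x y) → AllPairs R (xs ++ ys)
AllPairs-++⁺ Rxs Rys Rxy = AllPairs.++⁺ Rxs Rys (All.tabulate λ x∈ → All.tabulate λ y∈ → Rxy x∈ y∈)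

AllPairs-ʳ++⁻ : ∀ {A : Set} {R : A → A → Set} xs {ys} → AllPairs R (xs ʳ++ ys) →
  AllPairs (flip R) xs × AllPairs R ys × (∀ {x y} → x ∈ xs → y ∈ ys → R x y)
AllPairs-ʳ++⁻ []       Rys = [] , Rys , λ ()
AllPairs-ʳ++⁻ (x ∷ xs) R* with AllPairs-ʳ++⁻ xs R*
... | Rxs , Rx ∷ Rys , Rxy = All.tabulate (λ y∈ → Rxy y∈ (here refl)) ∷ Rxs , Rys , λ
  { (here refl) y∈ → All.lookup Rx y∈ ; (there x∈) y∈ → Rxy x∈ (there y∈) }

AllPairs-ʳ++⁺ : ∀ {A : Set} {R : A → A → Set} {xs ys} → AllPairs (flip R) xs → AllPairs R ys →
  (∀ {x y} → x ∈ xs → y ∈ ys → R x y) → AllPairs R (xs ʳ++ ys)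
AllPairs-ʳ++⁺ []         Rys Rxy = Rys
AllPairs-ʳ++⁺ (Rx ∷ Rxs) Rys Rxy = AllPairs-ʳ++⁺ Rxs (All.tabulate (Rxy (here refl)) ∷ Rys) λ
  { x∈ (here refl) → All.lookup Rx x∈ ; x∈ (there y∈) → Rxy (there x∈) y∈ }

∈-ʳ++⁻ : ∀ {A : Set} (xs : List A) {ys x} → x ∈ xs ʳ++ ys → x ∈ xs ⊎ x ∈ ys
∈-ʳ++⁻ xs {ys} x∈ = ∈-++⁻ xs (∈-resp-↭ (↭-sym (++↭ʳ++ xs ys)) x∈)

∈-ʳ++⁺ˡ : ∀ {A : Set} {xs ys : List A} {x} → x ∈ xs → x ∈ xs ʳ++ ys
∈-ʳ++⁺ˡ {xs = xs} {ys} x∈ = ∈-resp-↭ (++↭ʳ++ xs ys) (∈-++⁺ˡ x∈)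

∈-ʳ++⁺ʳ : ∀ {A : Set} (xs : List A) {ys} {x} → x ∈ ys → x ∈ xs ʳ++ ys
∈-ʳ++⁺ʳ xs {ys} x∈ = ∈-resp-↭ (++↭ʳ++ xs ys) (∈-++⁺ʳ xs x∈)

rank : List ℕ → ℕ → ℕ
rank []       x = 0
rank (y ∷ ys) x with x ≟ y
... | yes _ = 0
... | no  _ = suc (rank ys x)

rank-< : ∀ {xs x} → x ∈ xs → rank xs x < length xs
rank-< {y ∷ ys} {x} x∈ with x ≟ y
... | yes _  = s≤s z≤n
rank-< (here x≡y) | no x≢y = contradiction x≡y x≢y
rank-< (there x∈) | no x≢y = s≤s (rank-< x∈)

rank-∷ : ∀ {y ys x} → x ≢ y → rank (y ∷ ys) x ≡ suc (rank ys x)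
rank-∷ {y} {ys} {x} x≢y with x ≟ y
... | yes x≡y = contradiction x≡y x≢y
... | no  _   = refl

rank-head : ∀ y ys → rank (y ∷ ys) y ≡ 0
rank-head y ys with y ≟ y
... | yes _  = refl
... | no y≢y = contradiction refl y≢y

rank-mono : ∀ {xs} → Unique xs → AllPairs (λ x y → rank xs x < rank xs y) xs
rank-mono {[]}     []         = []
rank-mono {y ∷ ys} (y∉ ∷ ys!) =
  All.map (λ {x} y≢x → subst₂ _<_ (sym (rank-head y ys)) (sym (rank-∷ (y≢x ∘ sym))) (s≤s z≤n)) y∉
  ∷ shifted y∉ (rank-mono ys!)
  where
  shifted : ∀ {zs} → All (y ≢_) zs → AllPairs (λ x z → rank ys x < rank ys z) zs →
            AllPairs (λ x z → rank (y ∷ ys) x < rank (y ∷ ys) z) zs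
  shifted []          []        = []
  shifted (y≢z ∷ y∉zs) (lt ∷ lts) =
    All.zipWith (λ (y≢x , z<x) → subst₂ _<_ (sym (rank-∷ (y≢z ∘ sym))) (sym (rank-∷ (y≢x ∘ sym))) (s≤s z<x)) (y∉zs , lt)
    ∷ shifted y∉zs lts

increasing-head : ∀ (p : ℕ → ℕ) {y ys b} → AllPairs (λ x z → p x < p z) (y ∷ ys) →
  All (λ x → p x < b) (y ∷ ys) → p y + length (y ∷ ys) ≤ b
increasing-head p {y} {[]} _ (py<b ∷ _) = ≤-trans (≤-reflexive (+-comm (p y) 1)) py<b
increasing-head p {y} {z ∷ zs} ((py<pz ∷ _) ∷ mono) (_ ∷ bounded) = ≤-trans
  (≤-reflexive (+-suc (p y) _))
  (≤-trans (+-monoˡ-≤ _ py<pz) (increasing-head p mono bounded))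

-- Strictly increasing values confined to an interval of `length xs` integers cannot skip any of
-- them.
increasing-rank : ∀ (p : ℕ → ℕ) lo {xs} → AllPairs (λ x y → p x < p y) xs → Unique xs →
  All (λ x → lo ≤ p x) xs → All (λ x → p x < lo + length xs) xs →
  ∀ {x} → x ∈ xs → p x ≡ lo + rank xs x
increasing-rank p lo {y ∷ ys} mono xs! (lo≤y ∷ _) bounded (here refl) = trans
  (≤-antisym (+-cancelʳ-≤ (length (y ∷ ys)) (p y) lo (increasing-head p mono bounded)) lo≤y)
  (trans (sym (+-identityʳ lo)) (cong (lo +_) (sym (rank-head y ys))))
increasing-rank p lo {y ∷ ys} (y< ∷ mono) (y∉ ∷ ys!) (lo≤y ∷ _) (_ ∷ bounded) (there x∈) = trans
  (increasing-rank p (suc lo) mono ys! (All.map (λ py<pz → ≤-<-trans lo≤y py<pz) y<)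
    (All.map (λ lt → ≤-trans lt (≤-reflexive (+-suc lo _))) bounded) x∈)
  (trans (sym (+-suc lo _)) (cong (lo +_) (sym (rank-∷ (All.lookup y∉ x∈ ∘ sym)))))

-- Directions, betweenness and cyclic order.

Dir : Bool → ℕ → ℕ → Set
Dir true  x y = y < x
Dir false x y = x < y

Dir-trans : ∀ d → Transitive (Dir d)
Dir-trans true  y<x z<y = <-trans z<y y<x
Dir-trans false x<y y<z = <-trans x<y y<z

Dir-asym : ∀ d {x y} → Dir d x y → ¬ Dir d y x
Dir-asym true  = <-asym
Dir-asym false = <-asym

Dir-irrefl : ∀ d {x y} → Dir d x y → x ≢ y
Dir-irrefl true  y<x refl = <-irrefl refl y<x
Dir-irrefl false x<y refl = <-irrefl refl x<y

Dir-total : ∀ d {x y} → x ≢ y → Dir d x y ⊎ Dir d y x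
Dir-total d {x} {y} x≢y with <-cmp x y
Dir-total true  x≢y | tri< x<y _ _ = inj₂ x<y
Dir-total false x≢y | tri< x<y _ _ = inj₁ x<y
... | tri≈ _ x≡y _ = contradiction x≡y x≢y
Dir-total true  x≢y | tri> _ _ y<x = inj₁ y<x
Dir-total false x≢y | tri> _ _ y<x = inj₂ y<x

ChainN CyclicChainN : ℕ → ℕ → ℕ → ℕ → Set
ChainN p q r s = p < q × q < r × r < s
CyclicChainN p q r s = ChainN p q r s ⊎ ChainN q r s p ⊎ ChainN r s p q ⊎ ChainN s p q r

Between : ℕ → ℕ → ℕ → Set
Between x y z = (x < y × y < z) ⊎ (z < y × y < x)

Dir⇒Between : ∀ d {x y z} → Dir d x y → Dir d y z → Between x y z
Dir⇒Between true  y<x z<y = inj₂ (z<y , y<x)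
Dir⇒Between false x<y y<z = inj₁ (x<y , y<z)

Between⇒Dir : ∀ d {x y z} → Dir d x z → Between x y z → Dir d x y × Dir d y z
Between⇒Dir true  z<x (inj₁ (x<y , y<z)) = contradiction z<x (<-asym (<-trans x<y y<z))
Between⇒Dir true  z<x (inj₂ (z<y , y<x)) = y<x , z<y
Between⇒Dir false x<z (inj₁ (x<y , y<z)) = x<y , y<z
Between⇒Dir false x<z (inj₂ (z<y , y<x)) = contradiction x<z (<-asym (<-trans z<y y<x))

cyclic-rotate : ∀ {p q r s} → CyclicChainN p q r s → CyclicChainN q r s p
cyclic-rotate (inj₁ h)               = inj₂ (inj₂ (inj₂ h))
cyclic-rotate (inj₂ (inj₁ h))        = inj₁ h
cyclic-rotate (inj₂ (inj₂ (inj₁ h))) = inj₂ (inj₁ h)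
cyclic-rotate (inj₂ (inj₂ (inj₂ h))) = inj₂ (inj₂ (inj₁ h))

-- In the cyclic order `p q r s`, exactly one of `q` and `s` lies strictly between `p` and `r`.
cyclic-separates : ∀ {p q r s} → CyclicChainN p q r s →
  (Between p q r → Between p s r) → (Between p s r → Between p q r) → ⊥
cyclic-separates (inj₁ (p<q , q<r , r<s)) to from with to (inj₁ (p<q , q<r))
... | inj₁ (_ , s<r) = <-asym r<s s<r
... | inj₂ (_ , s<p) = <-asym (<-trans p<q (<-trans q<r r<s)) s<p
cyclic-separates (inj₂ (inj₁ (q<r , r<s , s<p))) to from with from (inj₂ (r<s , s<p))
... | inj₁ (p<q , _) = <-asym (<-trans q<r (<-trans r<s s<p)) p<q
... | inj₂ (r<q , _) = <-asym q<r r<q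
cyclic-separates (inj₂ (inj₂ (inj₁ (r<s , s<p , p<q)))) to from with from (inj₂ (r<s , s<p))
... | inj₁ (_ , q<r) = <-asym (<-trans r<s (<-trans s<p p<q)) q<r
... | inj₂ (_ , q<p) = <-asym p<q q<p
cyclic-separates (inj₂ (inj₂ (inj₂ (s<p , p<q , q<r)))) to from with to (inj₁ (p<q , q<r))
... | inj₁ (p<s , _) = <-asym s<p p<s
... | inj₂ (r<s , _) = <-asym (<-trans s<p (<-trans p<q q<r)) r<s

-- If `s` lay outside, the cyclic order would be `p q r s` when `p < r` and `p s r q` when `r < p`;
-- hence the two hypotheses on chains.
noncrossing-between : ∀ {p q r s} → ¬ CyclicChainN p q r s → ¬ CyclicChainN p s r q →
  s ≢ p → s ≢ r → Between p q r → Between p s r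
noncrossing-between {p} {q} {r} {s} ¬c ¬c′ s≢p s≢r b with <-cmp s p | <-cmp s r | b
... | tri≈ _ s≡p _ | _ | _ = contradiction s≡p s≢p
... | _ | tri≈ _ s≡r _ | _ = contradiction s≡r s≢r
... | tri> _ _ p<s | tri< s<r _ _ | _ = inj₁ (p<s , s<r)
... | tri< s<p _ _ | tri> _ _ r<s | _ = inj₂ (r<s , s<p)
... | tri< s<p _ _ | tri< s<r _ _ | inj₁ (p<q , q<r) = contradiction (inj₂ (inj₂ (inj₂ (s<p , p<q , q<r)))) ¬c
... | tri< s<p _ _ | tri< s<r _ _ | inj₂ (r<q , q<p) = contradiction (inj₂ (inj₁ (s<r , r<q , q<p))) ¬c′
... | tri> _ _ p<s | tri> _ _ r<s | inj₁ (p<q , q<r) = contradiction (inj₁ (p<q , q<r , r<s)) ¬c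
... | tri> _ _ p<s | tri> _ _ r<s | inj₂ (r<q , q<p) = contradiction (inj₂ (inj₂ (inj₁ (r<q , q<p , p<s)))) ¬c′

-- Partial stacks and the placing of one more face.

Realizes : (ℕ → ℕ → Set) → ℕ → List ℕ → List ℕ → Set
Realizes D e P Q = AllPairs D (e ∷ P) × AllPairs (flip D) (e ∷ Q)

-- The child's two lists lie on opposite sides of `f`, so every comparison with `rest` that the
-- parent needs goes through `f` by transitivity.
realizes-step⁻ : ∀ {D e f Q} seg {rest} → Transitive D →
  Realizes (flip D) f (seg ʳ++ e ∷ Q) rest →
  Realizes D e (seg ++ rest) Q × All (λ x → D x f) seg × All (D f) rest × D e f
realizes-step⁻ {D} {e} {f} seg D-trans (f> ∷ sorted , f< ∷ rest-sorted) with AllPairs-ʳ++⁻ seg sorted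
... | seg-sorted , e> ∷ Q-sorted , cross =
  let seg<f = All.tabulate (λ x∈ → All.lookup f> (∈-ʳ++⁺ˡ x∈))
      e<f   = All.lookup f> (∈-ʳ++⁺ʳ seg (here refl))
  in ((All.++⁺ (All.tabulate λ x∈ → cross x∈ (here refl)) (All.map (D-trans e<f) f<)
        ∷ AllPairs-++⁺ seg-sorted rest-sorted
            (λ x∈ y∈ → D-trans (All.lookup seg<f x∈) (All.lookup f< y∈)))
      , (e> ∷ Q-sorted))
     , seg<f , f< , e<f

realizes-step⁺ : ∀ {D e f Q} seg {rest} → Transitive D →
  Realizes D e (seg ++ rest) Q → All (λ x → D x f) seg → All (D f) rest → D e f →
  Realizes (flip D) f (seg ʳ++ e ∷ Q) rest
realizes-step⁺ {D} {e} {f} {Q} seg D-trans (e< ∷ sorted , e> ∷ Q-sorted) seg<f f<rest e<f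
  with AllPairs-++⁻ seg sorted
... | seg-sorted , rest-sorted , cross =
  (All.tabulate (λ x∈ → before-f (∈-ʳ++⁻ seg x∈))
    ∷ AllPairs-ʳ++⁺ seg-sorted (e> ∷ Q-sorted) after)
  , (f<rest ∷ rest-sorted)
  where
  before-f : ∀ {x} → x ∈ seg ⊎ x ∈ e ∷ Q → D x f
  before-f (inj₁ x∈)          = All.lookup seg<f x∈
  before-f (inj₂ (here refl)) = e<f
  before-f (inj₂ (there x∈))  = D-trans (All.lookup e> x∈) e<f
  after : ∀ {x y} → x ∈ seg → y ∈ e ∷ Q → D y x
  after x∈ (here refl) = All.lookup (All.++⁻ˡ seg e<) x∈
  after x∈ (there y∈)  = D-trans (All.lookup e> y∈) (All.lookup (All.++⁻ˡ seg e<) x∈)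

-- The crease `(e, e+1)` embraces exactly the faces jumped over, so it avoids an earlier crease of
-- its parity precisely when both or neither of that crease's faces are among them.
Closed : ℕ → List ℕ → Set
Closed e xs = ∀ {i} → i < e → isEven i ≡ isEven e → (i ∈ xs → suc i ∈ xs) × (suc i ∈ xs → i ∈ xs)

closed-[] : ∀ {e} → Closed e []
closed-[] _ _ = (λ ()) , λ ()

closed-++ : ∀ {e xs ys} → Closed e xs → Closed e ys → Closed e (xs ++ ys)
closed-++ {xs = xs} cx cy i<e par =
    ([ ∈-++⁺ˡ ∘ proj₁ (cx i<e par) , ∈-++⁺ʳ xs ∘ proj₁ (cy i<e par) ]′ ∘ ∈-++⁻ xs)
  , ([ ∈-++⁺ˡ ∘ proj₂ (cx i<e par) , ∈-++⁺ʳ xs ∘ proj₂ (cy i<e par) ]′ ∘ ∈-++⁻ xs)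

-- x and y are joined by a crease on the same side of the stack as crease (e, e+1).
Mate : ℕ → ℕ → ℕ → Set
Mate e x y = (y ≡ suc x × isEven x ≡ isEven e) ⊎ (x ≡ suc y × isEven y ≡ isEven e)

-- Strips with an arbitrary direction for each crease.

module Strip {m} (μ : Assignment m) (δ : ℕ → Bool)
             (δ-μ : ∀ i → descends (μ i) (toℕ i) ≡ δ (toℕ i)) where

  -- Stated for position functions on all of ℕ and for the first `n` creases, so that one notion
  -- serves every partial stack.
  record Folded (p : ℕ → ℕ) (n : ℕ) : Set where
    field
      crease  : ∀ {i} → i < n → Dir (δ i) (p i) (p (suc i))
      nocross : ∀ {i j} → i < n → j < n → isEven i ≡ isEven j →
                ¬ CyclicChainN (p i) (p j) (p (suc i)) (p (suc j))
  open Folded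

  pos : Ordering m → ℕ → ℕ
  pos σ x with x <? suc m
  ... | yes x<n = toℕ (lookup σ (fromℕ< x<n))
  ... | no  _   = 0

  pos-fromℕ< : ∀ σ {x} (x<n : x < suc m) → pos σ x ≡ toℕ (lookup σ (fromℕ< x<n))
  pos-fromℕ< σ {x} x<n with x <? suc m
  ... | yes _  = refl
  ... | no x≮n = contradiction x<n x≮n

  pos-toℕ : ∀ σ i {x} → toℕ i ≡ x → pos σ x ≡ toℕ (lookup σ i)
  pos-toℕ σ i refl = trans (pos-fromℕ< σ (toℕ<n i)) (cong (toℕ ∘ lookup σ) (fromℕ<-toℕ i (toℕ<n i)))

  pos-< : ∀ σ {x} → x < suc m → pos σ x < suc m
  pos-< σ x<n = subst (_< suc m) (sym (pos-fromℕ< σ x<n)) (toℕ<n _)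

  if-Dir : ∀ {n} b (x y : Fin n) → (if b then y Fin.< x else x Fin.< y) ≡ Dir b (toℕ x) (toℕ y)
  if-Dir true  x y = refl
  if-Dir false x y = refl

  module _ (σ : Ordering m) (i : Fin m) where
    pos-left : pos σ (toℕ i) ≡ toℕ (lookup σ (inject₁ i))
    pos-left = pos-toℕ σ (inject₁ i) (toℕ-inject₁ i)

    pos-right : pos σ (suc (toℕ i)) ≡ toℕ (lookup σ (Fin.suc i))
    pos-right = pos-toℕ σ (Fin.suc i) refl

    cond1≡ : Cond1 μ σ i ≡ Dir (δ (toℕ i)) (pos σ (toℕ i)) (pos σ (suc (toℕ i)))
    cond1≡ = trans (if-Dir (descends (μ i) (toℕ i)) _ _)
      (trans (cong (λ d → Dir d _ _) (δ-μ i)) (sym (cong₂ (Dir (δ (toℕ i))) pos-left pos-right)))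

  chain≡ : ∀ σ i j → CyclicChain (lookup σ (inject₁ i)) (lookup σ (inject₁ j)) (lookup σ (Fin.suc i)) (lookup σ (Fin.suc j))
    ≡ CyclicChainN (pos σ (toℕ i)) (pos σ (toℕ j)) (pos σ (suc (toℕ i))) (pos σ (suc (toℕ j)))
  chain≡ σ i j rewrite pos-left σ i | pos-left σ j | pos-right σ i | pos-right σ j = refl

  valid⇒folded : ∀ {σ} → ValidOrdering μ σ → Folded (pos σ) m
  valid⇒folded {σ} (_ , c₁ , c₂) = record
    { crease  = λ i<m → subst (λ i → Dir (δ i) (pos σ i) (pos σ (suc i))) (toℕ-fromℕ< i<m)
        (subst (λ A → A) (cond1≡ σ (fromℕ< i<m)) (c₁ (fromℕ< i<m)))
    ; nocross = λ i<m j<m → subst₂ (λ i j → isEven i ≡ isEven j → ¬ CyclicChainN (pos σ i) (pos σ j) (pos σ (suc i)) (pos σ (suc j)))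
        (toℕ-fromℕ< i<m) (toℕ-fromℕ< j<m)
        (subst (λ A → isEven (toℕ (fromℕ< i<m)) ≡ isEven (toℕ (fromℕ< j<m)) → ¬ A) (chain≡ σ _ _) (c₂ (fromℕ< i<m) (fromℕ< j<m)))
    }

  folded⇒valid : ∀ {σ} → (∀ {x y} → x < suc m → y < suc m → pos σ x ≡ pos σ y → x ≡ y) →
    Folded (pos σ) m → ValidOrdering μ σ
  folded⇒valid {σ} inj fold =
      (λ i j eq → toℕ-injective (inj (toℕ<n i) (toℕ<n j)
        (trans (pos-toℕ σ i refl) (trans (cong toℕ eq) (sym (pos-toℕ σ j refl))))))
    , (λ i → subst (λ A → A) (sym (cond1≡ σ i)) (crease fold (toℕ<n i)))
    , (λ i j par → subst ¬_ (sym (chain≡ σ i j)) (nocross fold (toℕ<n i) (toℕ<n j) par))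

  valid-injective : ∀ {σ} → ValidOrdering μ σ → ∀ {x y} → x < suc m → y < suc m → pos σ x ≡ pos σ y → x ≡ y
  valid-injective {σ} (inj , _) x<n y<n eq = trans (sym (toℕ-fromℕ< x<n)) (trans
    (cong toℕ (inj _ _ (toℕ-injective (trans (sym (pos-fromℕ< σ x<n)) (trans eq (pos-fromℕ< σ y<n))))))
    (toℕ-fromℕ< y<n))

  -- `perm` says that exactly the faces up to `e` have been stacked. `sound` ranges over all
  -- position functions: whether a partial stack is legal depends on the order of its faces alone,
  -- so it is checked once per step and passes to every ordering that realizes this order.
  record Reach (d : Bool) (e : ℕ) (P Q : List ℕ) : Set where
    constructor reach
    field
      perm  : e ∷ P ++ Q ↭ downFrom (suc e)
      sound : ∀ p → Realizes (Dir d on p) e P Q → Folded p e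

  module _ {d e P Q} (R : Reach d e P Q) where
    open Reach R

    faces-unique : Unique (e ∷ P ++ Q)
    faces-unique = PermutationS.Unique-resp-↭ (setoid ℕ) (↭⇒↭ₛ (↭-sym perm)) (Unique.downFrom⁺ (suc e))

    face-< : ∀ {x} → x ∈ P ++ Q → x < e
    face-< x∈ = ≤∧≢⇒< (s≤s⁻¹ (∈-downFrom⁻ (∈-resp-↭ perm (there x∈))))
      λ { refl → Unique.Unique[x∷xs]⇒x∉xs faces-unique x∈ }

    face-∈ : ∀ {x} → x < e → x ∈ P ++ Q
    face-∈ x<e with ∈-resp-↭ (↭-sym perm) (∈-downFrom⁺ (m<n⇒m<1+n x<e))
    ... | here refl = contradiction x<e (<-irrefl refl)
    ... | there x∈  = x∈

  reach-swap : ∀ {d e P Q} → Reach d e P Q → Reach (not d) e Q P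
  reach-swap {d} {e} {P} {Q} (reach perm sound) = reach
    (↭-trans (↭-prep e (++-comm Q P)) perm)
    λ p (Qs , Ps) → sound p (turn d Ps , turn⁻ d Qs)
    where
    turn : ∀ d {p : ℕ → ℕ} {xs} → AllPairs (flip (Dir (not d) on p)) xs → AllPairs (Dir d on p) xs
    turn true  = λ z → z
    turn false = λ z → z
    turn⁻ : ∀ d {p : ℕ → ℕ} {xs} → AllPairs (Dir (not d) on p) xs → AllPairs (flip (Dir d on p)) xs
    turn⁻ true  = λ z → z
    turn⁻ false = λ z → z

  realizes-flip : ∀ d {p : ℕ → ℕ} {e P Q} → Realizes (Dir (not d) on p) e P Q → Realizes (flip (Dir d on p)) e P Q
  realizes-flip true  r = r
  realizes-flip false r = r

  realizes-flip⁻ : ∀ d {p : ℕ → ℕ} {e P Q} → Realizes (flip (Dir d on p)) e P Q → Realizes (Dir (not d) on p) e P Q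
  realizes-flip⁻ true  r = r
  realizes-flip⁻ false r = r

  -- Only crossings with the new crease remain to be excluded. The earlier faces between `e` and
  -- `e+1` are exactly those of `seg`, and `Closed` puts both or neither face of an older crease of
  -- the same parity there.
  reach-step : ∀ {e seg rest Q} → Closed e seg → Reach (δ e) e (seg ++ rest) Q →
    Reach (not (δ e)) (suc e) (seg ʳ++ e ∷ Q) rest
  reach-step {e} {seg} {rest} {Q} closed R@(reach perm sound) = reach perm′ sound′
    where
    perm′ : suc e ∷ (seg ʳ++ e ∷ Q) ++ rest ↭ downFrom (suc (suc e))
    perm′ = ↭-prep (suc e) (↭-trans rearrange perm)
      where
      open PermutationReasoning
      rearrange : (seg ʳ++ e ∷ Q) ++ rest ↭ e ∷ (seg ++ rest) ++ Q
      rearrange = begin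
        (seg ʳ++ e ∷ Q) ++ rest   ↭⟨ ++⁺ʳ rest (++↭ʳ++ seg (e ∷ Q)) ⟨
        (seg ++ e ∷ Q) ++ rest    ↭⟨ ++⁺ʳ rest (shift e seg Q) ⟩
        e ∷ (seg ++ Q) ++ rest    ≡⟨ cong (e ∷_) (++-assoc seg Q rest) ⟩
        e ∷ seg ++ (Q ++ rest)    ↭⟨ ↭-prep e (++⁺ˡ seg (++-comm Q rest)) ⟩
        e ∷ seg ++ (rest ++ Q)    ≡⟨ cong (e ∷_) (++-assoc seg rest Q) ⟨
        e ∷ (seg ++ rest) ++ Q    ∎

    sound′ : ∀ p → Realizes (Dir (not (δ e)) on p) (suc e) (seg ʳ++ e ∷ Q) rest → Folded p (suc e)
    sound′ p r with realizes-step⁻ {D = Dir (δ e) on p} seg (Dir-trans (δ e)) (realizes-flip (δ e) r)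
    ... | parent@(e< ∷ _ , e> ∷ _) , seg<f , f<rest , e<f = record { crease = creases ; nocross = nocrosses }
      where
      old : Folded p e
      old = sound p parent

      creases : ∀ {i} → i < suc e → Dir (δ i) (p i) (p (suc i))
      creases i<1+e with m<1+n⇒m<n∨m≡n i<1+e
      ... | inj₁ i<e  = crease old i<e
      ... | inj₂ refl = e<f

      inside⇒∈ : ∀ {x} → x < e → Between (p e) (p x) (p (suc e)) → x ∈ seg
      inside⇒∈ x<e b with Between⇒Dir (δ e) e<f b | ∈-++⁻ (seg ++ rest) (face-∈ R x<e)
      ... | e<x , _ | inj₂ x∈Q = contradiction e<x (Dir-asym (δ e) (All.lookup e> x∈Q))
      ... | _ , x<f | inj₁ x∈P with ∈-++⁻ seg x∈P
      ...   | inj₁ x∈seg  = x∈seg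
      ...   | inj₂ x∈rest = contradiction x<f (Dir-asym (δ e) (All.lookup f<rest x∈rest))

      ∈⇒inside : ∀ {x} → x ∈ seg → Between (p e) (p x) (p (suc e))
      ∈⇒inside x∈ = Dir⇒Between (δ e) (All.lookup e< (∈-++⁺ˡ x∈)) (All.lookup seg<f x∈)

      both : ∀ {i} → i < e → isEven i ≡ isEven e →
        (Between (p e) (p i) (p (suc e)) → Between (p e) (p (suc i)) (p (suc e))) ×
        (Between (p e) (p (suc i)) (p (suc e)) → Between (p e) (p i) (p (suc e)))
      both {i} i<e par =
          (λ b → ∈⇒inside (proj₁ (closed i<e par) (inside⇒∈ i<e b)))
        , (λ b → ∈⇒inside (proj₂ (closed i<e par) (inside⇒∈ 1+i<e b)))
        where
        -- `suc i` is not `e`, because `i` has the parity of `e`.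
        1+i<e : suc i < e
        1+i<e = ≤∧≢⇒< i<e λ { refl → not-¬ refl par }

      nocrosses : ∀ {i j} → i < suc e → j < suc e → isEven i ≡ isEven j →
        ¬ CyclicChainN (p i) (p j) (p (suc i)) (p (suc j))
      nocrosses i<1+e j<1+e par cyc with m<1+n⇒m<n∨m≡n i<1+e | m<1+n⇒m<n∨m≡n j<1+e
      ... | inj₁ i<e  | inj₁ j<e  = nocross old i<e j<e par cyc
      ... | inj₂ refl | inj₁ j<e  = cyclic-separates cyc (proj₁ (both j<e (sym par))) (proj₂ (both j<e (sym par)))
      ... | inj₁ i<e  | inj₂ refl = cyclic-separates (cyclic-rotate cyc) (proj₂ (both i<e par)) (proj₁ (both i<e par))
      -- The new crease against itself: `Between` is strict, so neither of its own faces lies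
      -- between them.
      ... | inj₂ refl | inj₂ refl = cyclic-separates cyc
        (λ { (inj₁ (lt , _)) → contradiction lt (<-irrefl refl) ; (inj₂ (_ , lt)) → contradiction lt (<-irrefl refl) })
        (λ { (inj₁ (_ , lt)) → contradiction lt (<-irrefl refl) ; (inj₂ (lt , _)) → contradiction lt (<-irrefl refl) })

  -- Counting the valid extensions of a partial stack.

  Extends : Bool → ℕ → List ℕ → List ℕ → Ordering m → Set
  Extends d e P Q σ = ValidOrdering μ σ × Realizes (Dir d on pos σ) e P Q

  -- n valid orderings extend the partial stack whose last face is e, with P (nearest face first)
  -- the faces on the side d of e and Q those on the other side.
  Counts : Bool → ℕ → List ℕ → List ℕ → ℕ → Set
  Counts d e P Q n = Reach d e P Q → Card (Extends d e P Q) n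

  ExtendsBeyond : ℕ → List ℕ → List ℕ → List ℕ → Ordering m → Set
  ExtendsBeyond e seg rest Q σ =
    Extends (δ e) e (seg ++ rest) Q σ × All (λ x → Dir (δ e) (pos σ x) (pos σ (suc e))) seg

  -- As Counts, for the orderings in which face e + 1 is stacked beyond the faces seg.
  CountsBeyond : ℕ → List ℕ → List ℕ → List ℕ → ℕ → Set
  CountsBeyond e seg rest Q n = Reach (δ e) e (seg ++ rest) Q → Card (ExtendsBeyond e seg rest Q) n

  counts-swap : ∀ {d e P Q n} → Counts (not d) e Q P n → Counts d e P Q n
  counts-swap {d} C R = Card-cong
    (λ (v , Qs , Ps) → v , proj₂ (realizes-flip d (Qs , Ps)) , proj₁ (realizes-flip d (Qs , Ps)))
    (λ (v , Ps , Qs) → v , realizes-flip⁻ d (Qs , Ps))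
    (C (reach-swap R))

  counts-from-start : ∀ {e P Q n} → CountsBeyond e [] P Q n → Counts (δ e) e P Q n
  counts-from-start C R = Card-cong proj₁ (_, []) (C R)

  module _ {e : ℕ} (e<m : e < m) where
    child⇒beyond : ∀ seg {rest Q σ} → Extends (not (δ e)) (suc e) (seg ʳ++ e ∷ Q) rest σ →
      ExtendsBeyond e seg rest Q σ × All (λ x → Dir (δ e) (pos σ (suc e)) (pos σ x)) rest
    child⇒beyond seg {σ = σ} (v , r)
      with realizes-step⁻ {D = Dir (δ e) on pos σ} seg (Dir-trans (δ e)) (realizes-flip (δ e) r)
    ... | parent , seg<f , f<rest , _ = ((v , parent) , seg<f) , f<rest

    beyond⇒child : ∀ seg {rest Q σ} → ExtendsBeyond e seg rest Q σ →
      All (λ x → Dir (δ e) (pos σ (suc e)) (pos σ x)) rest → Extends (not (δ e)) (suc e) (seg ʳ++ e ∷ Q) rest σ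
    beyond⇒child seg {σ = σ} ((v , r) , seg<f) f<rest = v ,
      realizes-flip⁻ (δ e) (realizes-step⁺ {D = Dir (δ e) on pos σ} seg (Dir-trans (δ e)) r seg<f f<rest
        (crease (valid⇒folded v) e<m))

    -- The crease joining `x` and `y` must not cross `(e, e+1)`, so `y` has to follow `x` into the
    -- space between `e` and `e+1`.
    mate-beyond : ∀ {σ x y} → ValidOrdering μ σ → x < e → y < e → Mate e x y →
      Dir (δ e) (pos σ e) (pos σ x) → Dir (δ e) (pos σ x) (pos σ (suc e)) →
      Dir (δ e) (pos σ e) (pos σ y) × Dir (δ e) (pos σ y) (pos σ (suc e))
    mate-beyond {σ} {x} {y} v x<e y<e mate e<x x<f = Between⇒Dir (δ e) (crease F e<m) (noncrossing-between
      (proj₁ (uncrossed mate)) (proj₂ (uncrossed mate))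
      (λ eq → <-irrefl (valid-injective v y<n e<n eq) y<e)
      (λ eq → <-irrefl (valid-injective v y<n (s≤s e<m) eq) (m<n⇒m<1+n y<e))
      (Dir⇒Between (δ e) e<x x<f))
      where
      F = valid⇒folded v
      e<n = m<n⇒m<1+n e<m
      y<n = <-trans y<e e<n
      uncrossed : Mate e x y → ¬ CyclicChainN (pos σ e) (pos σ x) (pos σ (suc e)) (pos σ y)
                             × ¬ CyclicChainN (pos σ e) (pos σ y) (pos σ (suc e)) (pos σ x)
      uncrossed (inj₁ (refl , par)) =
          nocross F e<m (<-trans x<e e<m) (sym par)
        , nocross F (<-trans x<e e<m) e<m par ∘ cyclic-rotate ∘ cyclic-rotate ∘ cyclic-rotate
      uncrossed (inj₂ (refl , par)) =
          nocross F (<-trans y<e e<m) e<m par ∘ cyclic-rotate ∘ cyclic-rotate ∘ cyclic-rotate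
        , nocross F e<m (<-trans y<e e<m) (sym par)

    -- To pass the first face `h` of `rest`, face `e+1` would have to pass the mate of `h` too, but
    -- this lies on the far side of `e`. So the gap in front of `rest` is the last one available.
    last-gap : ∀ {seg rest Q n} → Closed e seg →
      (∀ {h R} → rest ≡ h ∷ R → ∃ λ y → y ∈ Q × Mate e h y) →
      Counts (not (δ e)) (suc e) (seg ʳ++ e ∷ Q) rest n → CountsBeyond e seg rest Q n
    last-gap {seg} {rest} {Q} closed blocked C R = Card-cong (proj₁ ∘ child⇒beyond seg) into (C (reach-step closed R))
      where
      into : ∀ {σ} → ExtendsBeyond e seg rest Q σ → Extends (not (δ e)) (suc e) (seg ʳ++ e ∷ Q) rest σ
      into {σ} b@((v , (e< ∷ sorted , e> ∷ _)) , _) = beyond⇒child seg b (f<rest rest refl)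
        where
        f<rest : ∀ rs → rest ≡ rs → All (λ x → Dir (δ e) (pos σ (suc e)) (pos σ x)) rs
        f<rest []      _    = []
        f<rest (h ∷ t) refl with Dir-total (δ e) {pos σ (suc e)} {pos σ h}
             (λ eq → <-irrefl (valid-injective v h<n (s≤s e<m) (sym eq)) (m<n⇒m<1+n h<e))
          where
          h<e = face-< R (∈-++⁺ˡ (∈-++⁺ʳ seg (here refl)))
          h<n = <-trans h<e (m<n⇒m<1+n e<m)
        ... | inj₁ f<h = f<h ∷ All.map (Dir-trans (δ e) f<h) (AllPairs.head (proj₁ (proj₂ (AllPairs-++⁻ seg sorted))))
        ... | inj₂ h<f with blocked refl
        ...   | y , y∈Q , mate = contradiction
          (proj₁ (mate-beyond v (face-< R (∈-++⁺ˡ (∈-++⁺ʳ seg (here refl)))) (face-< R (∈-++⁺ʳ (seg ++ rest) y∈Q)) mate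
            (All.lookup e< (∈-++⁺ʳ seg (here refl))) h<f))
          (Dir-asym (δ e) (All.lookup e> y∈Q))

    -- Face `e+1` either stops in front of `h`, or passes `h`, hence its mate `y`, hence everything
    -- up to `y`. No gap inside the block `h ∷ S₁` is possible, and the two cases add up. The tie
    -- `h ≡ y` serves blocks of one face.
    next-gap : ∀ {seg h S₁ S₀ y rest Q k l} → Closed e seg →
      h ∷ S₁ ≡ S₀ ∷ʳ y → h ≡ y ⊎ Mate e h y →
      Counts (not (δ e)) (suc e) (seg ʳ++ e ∷ Q) (h ∷ S₁ ++ rest) k →
      CountsBeyond e (seg ++ h ∷ S₁) rest Q l →
      CountsBeyond e seg (h ∷ S₁ ++ rest) Q (k + l)
    next-gap {seg} {h} {S₁} {S₀} {y} {rest} {Q} closed S≡ tie C C′ R = Card-⊎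
      split (proj₁ ∘ child⇒beyond seg) shrink
      (λ child (_ , S<f) → Dir-asym (δ e) (All.lookup (All.++⁻ʳ seg S<f) (here refl)) (All.head (proj₂ (child⇒beyond seg child))))
      (C (reach-step closed R))
      (C′ (subst (λ P → Reach (δ e) e P Q) (sym (++-assoc seg (h ∷ S₁) rest)) R))
      where
      P≡ = ++-assoc seg (h ∷ S₁) rest

      shrink : ∀ {σ} → ExtendsBeyond e (seg ++ h ∷ S₁) rest Q σ → ExtendsBeyond e seg (h ∷ S₁ ++ rest) Q σ
      shrink {σ} (x , S<f) = subst (λ P → Extends (δ e) e P Q σ) P≡ x , All.++⁻ˡ seg S<f

      h∈ : h ∈ seg ++ h ∷ S₁ ++ rest
      h∈ = ∈-++⁺ʳ seg (here refl)
      S⊆ : ∀ {x} → x ∈ h ∷ S₁ → x ∈ seg ++ h ∷ S₁ ++ rest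
      S⊆ x∈ = ∈-++⁺ʳ seg (∈-++⁺ˡ x∈)
      y∈ : y ∈ h ∷ S₁
      y∈ = subst (y ∈_) (sym S≡) (∈-++⁺ʳ S₀ (here refl))

      split : ∀ {σ} → ExtendsBeyond e seg (h ∷ S₁ ++ rest) Q σ →
        Extends (not (δ e)) (suc e) (seg ʳ++ e ∷ Q) (h ∷ S₁ ++ rest) σ ⊎ ExtendsBeyond e (seg ++ h ∷ S₁) rest Q σ
      split {σ} b@((v , (e< ∷ sorted , e>)) , seg<f) with Dir-total (δ e) {pos σ (suc e)} {pos σ h}
           (λ eq → <-irrefl (valid-injective v h<n (s≤s e<m) (sym eq)) (m<n⇒m<1+n h<e))
        where
        h<e = face-< R (∈-++⁺ˡ h∈)
        h<n = <-trans h<e (m<n⇒m<1+n e<m)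
      ... | inj₁ f<h = inj₁ (beyond⇒child seg b (f<h ∷ All.map (Dir-trans (δ e) f<h) (AllPairs.head (proj₁ (proj₂ (AllPairs-++⁻ seg sorted))))))
      ... | inj₂ h<f = inj₂ (subst (λ P → Extends (δ e) e P Q σ) (sym P≡) (v , (e< ∷ sorted , e>)) , All.++⁺ seg<f S<f)
        where
        -- The last face of the block is passed, and sortedness carries the rest of the block along.
        y<f : h ≡ y ⊎ Mate e h y → Dir (δ e) (pos σ y) (pos σ (suc e))
        y<f (inj₁ refl) = h<f
        y<f (inj₂ mate) = proj₂ (mate-beyond v (face-< R (∈-++⁺ˡ h∈)) (face-< R (∈-++⁺ˡ (S⊆ y∈))) mate
          (All.lookup e< h∈) h<f)
        S-sorted : AllPairs (Dir (δ e) on pos σ) (S₀ ∷ʳ y)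
        S-sorted = subst (AllPairs _) S≡ (proj₁ (AllPairs-++⁻ (h ∷ S₁) (proj₁ (proj₂ (AllPairs-++⁻ seg sorted)))))
        S<f : All (λ x → Dir (δ e) (pos σ x) (pos σ (suc e))) (h ∷ S₁)
        S<f = subst (All _) (sym S≡) (All.++⁺
          (All.tabulate λ x∈ → Dir-trans (δ e) (proj₂ (proj₂ (AllPairs-++⁻ S₀ S-sorted)) x∈ (here refl)) (y<f tie))
          (y<f tie ∷ []))

  -- Complete stacks.

  realizes⇒sorted : ∀ {D e P Q} → Transitive D → Realizes D e P Q → AllPairs D (Q ʳ++ e ∷ P)
  realizes⇒sorted D-trans (e< ∷ Ps , e> ∷ Qs) = AllPairs-ʳ++⁺ Qs (e< ∷ Ps) λ
    { x∈ (here refl) → All.lookup e> x∈ ; x∈ (there y∈) → D-trans (All.lookup e> x∈) (All.lookup e< y∈) }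

  sorted⇒realizes : ∀ {D e P} Q → AllPairs D (Q ʳ++ e ∷ P) → Realizes D e P Q
  sorted⇒realizes Q sorted with AllPairs-ʳ++⁻ Q sorted
  ... | Qs , Ps , cross = Ps , (All.tabulate (λ x∈ → cross x∈ (here refl)) ∷ Qs)

  -- Once all faces are stacked, each position has to be the rank in `Q ʳ++ m ∷ P`, the stack read
  -- from left to right. `sound` makes this ordering valid, and `increasing-rank` makes it the only
  -- one.
  counts-complete-right : ∀ {P Q} → Counts false m P Q 1
  counts-complete-right {P} {Q} R@(reach perm sound) =
    Card-singleton σ (folded⇒valid pos-injective (sound (pos σ) r) , r) only
    where
    T = Q ʳ++ m ∷ P
    T↭ : T ↭ downFrom (suc m)
    T↭ = ↭-trans (↭-sym (++↭ʳ++ Q (m ∷ P))) (↭-trans (++-comm Q (m ∷ P)) perm)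
    T! : Unique T
    T! = PermutationS.Unique-resp-↭ (setoid ℕ) (↭⇒↭ₛ (↭-sym T↭)) (Unique.downFrom⁺ (suc m))
    T-length : length T ≡ suc m
    T-length = trans (↭-length T↭) (length-downFrom (suc m))
    ∈T : ∀ {x} → x < suc m → x ∈ T
    ∈T x<n = ∈-resp-↭ (↭-sym T↭) (∈-downFrom⁺ x<n)
    T∋ : ∀ {x} → x ∈ T → x < suc m
    T∋ x∈ = ∈-downFrom⁻ (∈-resp-↭ T↭ x∈)
    position : Fin (suc m) → Fin (suc m)
    position i = fromℕ< (subst (rank T (toℕ i) <_) T-length (rank-< (∈T (toℕ<n i))))
    σ = Vec.tabulate position
    pos-rank : ∀ {x} → x < suc m → pos σ x ≡ rank T x
    pos-rank {x} x<n = trans (pos-fromℕ< σ x<n) (trans (cong toℕ (lookup∘tabulate position (fromℕ< x<n)))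
      (trans (toℕ-fromℕ< _) (cong (rank T) (toℕ-fromℕ< x<n))))
    sorted : AllPairs (Dir false on pos σ) T
    sorted = transport (All.tabulate T∋) (rank-mono T!)
      where
      transport : ∀ {xs} → All (_< suc m) xs → AllPairs (λ x y → rank T x < rank T y) xs → AllPairs (Dir false on pos σ) xs
      transport []           []         = []
      transport (x<n ∷ xs<n) (lt ∷ lts) =
        All.zipWith (λ (y<n , x<y) → subst₂ _<_ (sym (pos-rank x<n)) (sym (pos-rank y<n)) x<y) (xs<n , lt)
        ∷ transport xs<n lts
    r : Realizes (Dir false on pos σ) m P Q
    r = sorted⇒realizes Q sorted
    pos-injective : ∀ {x y} → x < suc m → y < suc m → pos σ x ≡ pos σ y → x ≡ y
    pos-injective x<n y<n eq with AllPairs-total sorted (∈T x<n) (∈T y<n)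
    ... | inj₁ x≡y        = x≡y
    ... | inj₂ (inj₁ x<y) = contradiction eq (Dir-irrefl false x<y)
    ... | inj₂ (inj₂ y<x) = contradiction (sym eq) (Dir-irrefl false y<x)
    only : ∀ {τ} → Extends false m P Q τ → τ ≡ σ
    only {τ} (_ , rτ) = Pointwise-≡⇒≡ (ext λ i → toℕ-injective
      (trans (sym (pos-toℕ τ i refl)) (trans (agree (toℕ<n i)) (pos-toℕ σ i refl))))
      where
      agree : ∀ {x} → x < suc m → pos τ x ≡ pos σ x
      agree x<n = trans
        (increasing-rank (pos τ) 0 (realizes⇒sorted {D = Dir false on pos τ} (Dir-trans false) rτ) T!
          (All.tabulate λ _ → z≤n) (All.tabulate λ {y} y∈ → subst (pos τ y <_) (sym T-length) (pos-< τ (T∋ y∈))) (∈T x<n))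
        (sym (pos-rank x<n))

  counts-complete : ∀ {P Q} d → Counts d m P Q 1
  counts-complete true  = counts-swap counts-complete-right
  counts-complete false = counts-complete-right

  c-from-start : ∀ {n} → Counts (δ 0) 0 [] [] n → c μ ≡ n
  c-from-start C = c-Card {μ = μ} (Card-cong proj₁ (λ v → v , ([] ∷ []) , ([] ∷ [])) (C (reach ↭-refl λ _ _ → record
    { crease = λ () ; nocross = λ () })))

-- Spirals and runs of consecutive faces.

-- The stack … 3 1 0 2 4 … of faces 0, …, k-1 rolled up in one direction, read from the side of face k - 2.
spiral : ℕ → List ℕ
spiral 0             = []
spiral 1             = [ 0 ]
spiral (suc (suc j)) = j ∷ spiral j ++ [ suc j ]

-- `j ∷ spiral j` is the roll `spiral (suc j)` read from its other side. Each of the two statements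
-- reduces to the other with one face less.
reverse-spiral : ∀ j ys → spiral (suc j) ʳ++ ys ≡ j ∷ spiral j ++ ys
spiral-reverse : ∀ j ys → (j ∷ spiral j) ʳ++ ys ≡ spiral (suc j) ++ ys
reverse-spiral 0 ys = refl
reverse-spiral 1 ys = refl
reverse-spiral (suc (suc i)) ys = trans (++-ʳ++ (suc i ∷ spiral (suc i))) (cong (suc (suc i) ∷_) (spiral-reverse (suc i) ys))
spiral-reverse 0 ys = refl
spiral-reverse 1 ys = refl
spiral-reverse (suc (suc i)) ys = trans (reverse-spiral (suc i) (suc (suc i) ∷ ys))
  (cong (suc i ∷_) (sym (++-assoc (spiral (suc i)) [ suc (suc i) ] ys)))

-- `Closed` depends only on the set of faces in a list, and the segments to be jumped over are built
-- from runs of consecutive labels.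
Interval : ℕ → ℕ → List ℕ → Set
Interval lo hi xs = ∀ {x} → (x ∈ xs → lo ≤ x × x < hi) × (lo ≤ x → x < hi → x ∈ xs)

interval-snoc : ∀ {lo hi xs} → lo ≤ hi → Interval lo hi xs → Interval lo (suc hi) (xs ∷ʳ hi)
interval-snoc {lo} {hi} {xs} lo≤hi I {x} = to ∘ ∈-++⁻ xs , from
  where
  to : x ∈ xs ⊎ x ∈ [ hi ] → lo ≤ x × x < suc hi
  to (inj₁ x∈) = proj₁ (proj₁ I x∈) , m<n⇒m<1+n (proj₂ (proj₁ I x∈))
  to (inj₂ (here refl)) = lo≤hi , ≤-refl
  from : lo ≤ x → x < suc hi → x ∈ xs ∷ʳ hi
  from lo≤x x<1+hi with m<1+n⇒m<n∨m≡n x<1+hi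
  ... | inj₁ x<hi = ∈-++⁺ˡ (proj₂ I lo≤x x<hi)
  ... | inj₂ refl = ∈-++⁺ʳ xs (here refl)

interval-cons : ∀ {lo hi xs} → lo < hi → Interval (suc lo) hi xs → Interval lo hi (lo ∷ xs)
interval-cons {lo} {hi} {xs} lo<hi I {x} = to , from
  where
  to : x ∈ lo ∷ xs → lo ≤ x × x < hi
  to (here refl) = ≤-refl , lo<hi
  to (there x∈)  = <⇒≤ (proj₁ (proj₁ I x∈)) , proj₂ (proj₁ I x∈)
  from : lo ≤ x → x < hi → x ∈ lo ∷ xs
  from lo≤x x<hi with m≤n⇒m<n∨m≡n lo≤x
  ... | inj₁ lo<x = there (proj₂ I lo<x x<hi)
  ... | inj₂ refl = here refl

interval-resp : ∀ {lo hi xs ys} → (∀ {x} → (x ∈ xs → x ∈ ys) × (x ∈ ys → x ∈ xs)) → Interval lo hi xs → Interval lo hi ys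
interval-resp same I = proj₁ I ∘ proj₂ same , λ lo≤ <hi → proj₁ same (proj₂ I lo≤ <hi)

interval-singleton : ∀ {x} → Interval x (suc x) [ x ]
interval-singleton = (λ { (here refl) → ≤-refl , ≤-refl }) , λ x≤y y<1+x → here (≤-antisym (s≤s⁻¹ y<1+x) x≤y)

∈-∷ʳ⇄ : ∀ {A : Set} {y x : A} (xs : List A) → (x ∈ y ∷ xs → x ∈ xs ∷ʳ y) × (x ∈ xs ∷ʳ y → x ∈ y ∷ xs)
∈-∷ʳ⇄ xs = (λ { (here refl) → ∈-++⁺ʳ xs (here refl) ; (there x∈) → ∈-++⁺ˡ x∈ })
          , λ x∈ → [ there , (λ { (here refl) → here refl }) ]′ (∈-++⁻ xs x∈)

spiral-interval : ∀ k → Interval 0 k (spiral k)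
turned-interval : ∀ j → Interval 0 (suc j) (j ∷ spiral j)
spiral-interval 0 = (λ ()) , λ _ ()
spiral-interval 1 = interval-singleton
spiral-interval (suc (suc j)) = interval-snoc z≤n (turned-interval j)
turned-interval j = interval-resp (λ {x} → swap (∈-∷ʳ⇄ (spiral j))) (interval-snoc z≤n (spiral-interval j))

-- The creases in question pair `i` with `i+1` for `i` of the parity of `e`, and a run that starts
-- and ends at this parity is a union of such pairs. A start at `0` is fine in either parity, since
-- face `0` has no partner below it.
interval-closed : ∀ {e lo hi xs} → Interval lo hi xs → lo ≡ 0 ⊎ isEven lo ≡ isEven e → isEven hi ≡ isEven e → Closed e xs
interval-closed {e} {lo} {hi} {xs} I lo-ok hi-ok {i} i<e par = up , down
  where
  up : i ∈ xs → suc i ∈ xs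
  up i∈ = proj₂ I (m≤n⇒m≤1+n (proj₁ (proj₁ I i∈)))
    (≤∧≢⇒< (proj₂ (proj₁ I i∈)) λ { refl → not-¬ refl (trans par (sym hi-ok)) })
  lo≤i : lo ≡ 0 ⊎ isEven lo ≡ isEven e → lo ≤ suc i → lo ≤ i
  lo≤i (inj₁ refl) _ = z≤n
  lo≤i (inj₂ lo-ok) lo≤1+i with m≤n⇒m<n∨m≡n lo≤1+i
  ... | inj₁ lo<1+i = s≤s⁻¹ lo<1+i
  ... | inj₂ refl   = contradiction (trans par (sym lo-ok)) (not-¬ refl)
  down : suc i ∈ xs → i ∈ xs
  down 1+i∈ = proj₂ I (lo≤i lo-ok (proj₁ (proj₁ I 1+i∈))) (<-trans (n<1+n i) (proj₂ (proj₁ I 1+i∈)))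

isEven-2+ : ∀ n → isEven (suc (suc n)) ≡ isEven n
isEven-2+ n = not-involutive (isEven n)

spiral-last : ∀ j → ∃ λ S₀ → spiral (suc j) ≡ S₀ ∷ʳ j
spiral-last 0       = [] , refl
spiral-last (suc j) = j ∷ spiral j , refl

-- The two outermost faces of a roll are consecutive and thus mates, so a single `next-gap` leads
-- past the whole roll.
turned-tie : ∀ {e} j → isEven (suc j) ≡ isEven e → ∃ λ S₀ → ∃ λ y → j ∷ spiral j ≡ S₀ ∷ʳ y × (j ≡ y ⊎ Mate e j y)
turned-tie 0       par = [] , 0 , refl , inj₁ refl
turned-tie (suc j) par with spiral-last j
... | S₀ , eq = suc j ∷ S₀ , j , cong (suc j ∷_) eq , inj₂ (inj₂ (refl , trans (sym (isEven-2+ j)) par))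

-- Corridors and the recursions for the counts.

-- Roll k faces up outwards and then d further ones inwards, inside face k: corridor k (d + 1) and
-- corridor k d are what the last face k + d sees on the near and on the far side.
corridor : ℕ → ℕ → List ℕ
corridor k 0             = []
corridor k 1             = spiral k
corridor k (suc (suc d)) = (k + d) ∷ corridor k d

-- Numbers of completions by r more faces of slope V: reversed d r when leaving a corridor of depth d,
-- crimped d r when the faces folded back so far lie at its bottom, capped r when they have covered
-- the whole outward roll.  Each face either starts the unique inward coil, which accounts for a
-- summand 1, or moves on; past an outward roll there are two ways of moving on.
capped : ℕ → ℕ
capped 0       = 1
capped (suc r) = suc (suc r + suc r)

crimped reversed : ℕ → ℕ → ℕ
crimped d       0       = 1
crimped 0       (suc r) = suc (capped r)
crimped (suc d) (suc r) = suc (reversed d r)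
reversed 1 r = crimped 1 r + suc r
reversed d r = crimped d r

-- The sum over the number d ≤ t of faces that the M-part rolls inwards.
rolled : ℕ → ℕ → ℕ
rolled 0       r = reversed 0 r
rolled (suc t) r = reversed (suc t) r + rolled t r

ʳ++-append : ∀ {A : Set} (xs : List A) {ys zs} → (xs ʳ++ ys) ++ zs ≡ xs ʳ++ ys ++ zs
ʳ++-append []       = refl
ʳ++-append (x ∷ xs) = ʳ++-append xs

isEven-pred : ∀ x y → isEven (suc x) ≡ isEven y → isEven x ≡ isEven (suc y)
isEven-pred x y par = trans (sym (not-involutive _)) (cong not par)

isEven-+2 : ∀ k d → isEven (k + suc (suc d)) ≡ isEven (k + d)
isEven-+2 k d = trans (cong isEven (trans (+-suc k (suc d)) (cong suc (+-suc k d)))) (isEven-2+ (k + d))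

-- Following the strip of `MᵃVᵇ`: faces of slope V.

module Spirals (a b : ℕ) where
  direction : ℕ → Bool
  direction i with i <? a
  ... | yes _ = isEven i
  ... | no  _ = not (isEven i)

  direction-descends : ∀ i → descends (MᵃVᵇ a b i) (toℕ i) ≡ direction (toℕ i)
  direction-descends i with toℕ i <? a
  ... | yes _ = refl
  ... | no  _ = refl

  direction-M : ∀ {i} → i < a → direction i ≡ isEven i
  direction-M {i} i<a with i <? a
  ... | yes _  = refl
  ... | no i≮a = contradiction i<a i≮a

  direction-V : ∀ {i} → a ≤ i → direction i ≡ not (isEven i)
  direction-V {i} a≤i with i <? a
  ... | yes i<a = contradiction a≤i (<⇒≱ i<a)
  ... | no  _   = refl

  open Strip (MᵃVᵇ a b) direction direction-descends

  -- With constant slope, the side that a step leaves behind is the one prescribed for the next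
  -- step, so children are again counted by `CountsV`.
  CountsV : ℕ → List ℕ → List ℕ → ℕ → Set
  CountsV e P Q n = Counts (not (isEven e)) e P Q n

  CountsM : ℕ → List ℕ → List ℕ → ℕ → Set
  CountsM e P Q n = Counts (isEven e) e P Q n

  resp-near : ∀ {e P P′ Q n} → P ≡ P′ → CountsV e P Q n → CountsV e P′ Q n
  resp-near refl C = C

  module _ {e r} (a≤e : a ≤ e) (e+r≡m : e + suc r ≡ a + b) where
    private
      dir = direction-V a≤e
    e<m : e < a + b
    e<m = subst (e <_) e+r≡m (m<m+n e {suc r} (s≤s z≤n))

    start-V : ∀ {P Q n} → CountsBeyond e [] P Q n → CountsV e P Q n
    start-V {P} {Q} {n} C = subst (λ d → Counts d e P Q n) dir (counts-from-start C)

    next-V : ∀ {P Q n} → CountsV (suc e) P Q n → Counts (not (direction e)) (suc e) P Q n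
    next-V {P} {Q} {n} C = subst (λ d → Counts (not d) (suc e) P Q n) (sym dir) C

    suc-e+r≡m : suc e + r ≡ a + b
    suc-e+r≡m = trans (sym (+-suc e r)) e+r≡m

  complete-V : ∀ {e P Q} → e + 0 ≡ a + b → CountsV e P Q 1
  complete-V {e} {P} {Q} eq = subst (λ e → CountsV e P Q 1) (trans (sym eq) (+-identityʳ e)) (counts-complete _)

  -- The mate of the nearest face `e+1` is `e`, on the far side, so `last-gap` leaves one gap only,
  -- and the new face is in the same situation again.
  coil : ∀ r {e P Q} → a ≤ suc (suc e) → suc (suc e) + r ≡ a + b → e ∈ Q → CountsV (suc (suc e)) (suc e ∷ P) Q 1
  coil zero    a≤e eq e∈Q = complete-V eq
  coil (suc r) {e} a≤e eq e∈Q = start-V a≤e eq (last-gap (e<m a≤e eq) closed-[]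
    (λ { refl → e , e∈Q , inj₂ (refl , sym (isEven-2+ e)) })
    (next-V a≤e eq (coil r (m≤n⇒m≤1+n a≤e) (suc-e+r≡m a≤e eq) (here refl))))

  -- A face `e+2` that takes the very first gap has `e+1` and `e` on opposite sides, which starts a
  -- coil. This is the summand `1` of each recursion.
  coil-back : ∀ r {e P Q} → a ≤ suc e → suc e + suc r ≡ a + b → e ∈ P →
    Counts (not (direction (suc e))) (suc (suc e)) (suc e ∷ Q) P 1
  coil-back r a≤e eq e∈P = next-V a≤e eq (coil r (m≤n⇒m≤1+n a≤e) (suc-e+r≡m a≤e eq) e∈P)

  -- A face that passes `j ∷ spiral j` is stopped by `suc j`, whose mate `suc (suc j)` is on the far
  -- side. It is then one layer deeper in the roll, with `suc j` in the role of `k`. Each of the `r`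
  -- faces thus offers one coil, and winding to the end is one more completion.
  winding-in : ∀ r k {e X Q} → a ≤ suc e → suc e + r ≡ a + b → isEven k ≡ isEven e → r < k → e ∈ X → k ∈ Q →
    CountsV (suc e) (spiral k ++ X) Q (suc r)
  winding-in zero k a≤e eq par r<k e∈X k∈Q = complete-V eq
  -- The bound `r < k` keeps the winding away from the centre of the roll.
  winding-in (suc r) (suc zero) a≤e eq par (s≤s ()) e∈X k∈Q
  winding-in (suc r) (suc (suc j)) {e} {X} {Q} a≤e eq par (s≤s r<k) e∈X k∈Q =
    let _ , _ , S≡ , tie = turned-tie {suc e} j par′ in
    resp-near (cong (j ∷_) (sym (++-assoc (spiral j) [ suc j ] X))) (start-V a≤e eq
      (next-gap (e<m a≤e eq) closed-[] S≡ tie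
        (coil-back r a≤e eq (there (∈-++⁺ʳ (spiral j) (there e∈X))))
        (last-gap (e<m a≤e eq)
          (interval-closed (turned-interval j) (inj₁ refl) par′)
          (λ { refl → suc (suc j) , k∈Q , inj₁ (refl , par′) })
          (next-V a≤e eq (resp-near (sym (spiral-reverse j _))
            (winding-in r (suc j) (m≤n⇒m≤1+n a≤e) (suc-e+r≡m a≤e eq) par′ r<k (here refl) (here refl)))))))
    where
    par′ : isEven (suc j) ≡ isEven (suc e)
    par′ = trans (sym (not-involutive _)) (cong not par)

  closed-all : ∀ {d e P} → Reach d e P [] → Closed e P
  closed-all {P = P} R {i} i<e par =
      (λ _ → subst (suc i ∈_) (++-identityʳ P) (face-∈ R (≤∧≢⇒< i<e λ { refl → not-¬ refl par })))
    , (λ _ → subst (i ∈_) (++-identityʳ P) (face-∈ R i<e))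

  -- With nothing on the far side, the new crease embraces every earlier face and can cross nothing.
  whole-gap : ∀ {e seg P n} → e < a + b → seg ≡ P →
    Counts (not (direction e)) (suc e) (P ʳ++ [ e ]) [] n → CountsBeyond e seg [] [] n
  whole-gap {e} {seg} e<m refl C R =
    last-gap e<m (closed-all (subst (λ P → Reach (direction e) e P []) (++-identityʳ seg) R)) (λ ()) C R

  -- The first and the last face of the near side are mates, so the next face coils up or wraps
  -- around the whole stack, and wrapping reproduces the situation.
  winding-out : ∀ r {e S₁ S₀} → a ≤ suc (suc e) → suc (suc e) + r ≡ a + b → e ∷ S₁ ≡ S₀ ∷ʳ suc e →
    CountsV (suc (suc e)) (e ∷ S₁) [] (suc r)
  winding-out zero    a≤e eq S≡ = complete-V eq
  winding-out (suc r) {e} {S₁} {S₀} a≤e eq S≡ = resp-near (++-identityʳ (e ∷ S₁)) (start-V a≤e eq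
    (next-gap (e<m a≤e eq) closed-[] S≡ (inj₂ (inj₁ (refl , sym (isEven-2+ e))))
      (coil-back r a≤e eq (∈-++⁺ˡ (subst (suc e ∈_) (sym S≡) (∈-++⁺ʳ S₀ (here refl)))))
      (whole-gap (e<m a≤e eq) refl (next-V a≤e eq
        (resp-near (sym turned)
          (winding-out r (m≤n⇒m≤1+n a≤e) (suc-e+r≡m a≤e eq) (trans (sym turned) (ʳ++-defn (e ∷ S₁)))))))))
    where
    turned : (e ∷ S₁) ʳ++ [ suc (suc e) ] ≡ suc e ∷ (S₀ ʳ++ [ suc (suc e) ])
    turned = trans (cong (_ʳ++ [ suc (suc e) ]) S≡) (++-ʳ++ S₀)

  -- The near side is the outward roll followed by the block `e ∷ C`, whose end faces are mates. The
  -- three gaps lead to a coil, into the roll (`winding-in`, with `suc j` in the block as the face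
  -- `k`), and around everything (`winding-out`).
  winding-capped : ∀ r j {e C C₀} → a ≤ suc (suc e) → suc (suc e) + r ≡ a + b →
    e ∷ C ≡ C₀ ∷ʳ suc e → isEven (suc j) ≡ isEven e → suc j ∈ e ∷ C → r ≤ suc j →
    CountsV (suc (suc e)) (j ∷ spiral j ++ e ∷ C) [] (capped r)
  winding-capped zero    j a≤e eq C≡ par j∈C r≤j = complete-V eq
  winding-capped (suc r) j {e} {C} {C₀} a≤e eq C≡ par j∈C r≤j
    with turned-tie {suc (suc e)} j (trans par (sym (isEven-2+ e)))
  ... | S₀ , y , S≡ , tie = resp-near (cong (λ C → j ∷ spiral j ++ C) (++-identityʳ (e ∷ C)))
    (start-V a≤e eq (next-gap (e<m a≤e eq) closed-[] S≡ tie
      (coil-back r a≤e eq (∈-++⁺ʳ (j ∷ spiral j) (∈-++⁺ˡ (subst (suc e ∈_) (sym C≡) (∈-++⁺ʳ C₀ (here refl))))))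
      (next-gap (e<m a≤e eq) {seg = j ∷ spiral j}
        (interval-closed (turned-interval j) (inj₁ refl) (trans par (sym (isEven-2+ e))))
        C≡ (inj₂ (inj₁ (refl , sym (isEven-2+ e))))
        (next-V a≤e eq (resp-near (sym (spiral-reverse j _))
          (winding-in r (suc j) (m≤n⇒m≤1+n a≤e) (suc-e+r≡m a≤e eq)
            (trans par (sym (isEven-2+ e))) r≤j (here refl) (∈-++⁺ˡ j∈C))))
        (whole-gap (e<m a≤e eq) refl (next-V a≤e eq (resp-near (sym turned)
          (winding-out r (m≤n⇒m≤1+n a≤e) (suc-e+r≡m a≤e eq)
            (trans (sym turned) (ʳ++-defn ((j ∷ spiral j) ++ e ∷ C))))))))))
    where
    turned : ((j ∷ spiral j) ++ e ∷ C) ʳ++ [ suc (suc e) ] ≡ suc e ∷ (C₀ ʳ++ ((j ∷ spiral j) ʳ++ [ suc (suc e) ]))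
    turned = trans (++-ʳ++ (j ∷ spiral j)) (trans (cong (_ʳ++ _) C≡) (++-ʳ++ C₀))

  ʳ++-interval : ∀ {lo hi xs} → lo ≤ hi → Interval lo hi xs → Interval lo (suc hi) (xs ʳ++ [ hi ])
  ʳ++-interval {hi = hi} {xs} lo≤hi I = interval-resp
    ( [ ∈-ʳ++⁺ˡ , ∈-ʳ++⁺ʳ xs ]′ ∘ ∈-++⁻ xs , [ ∈-++⁺ˡ , ∈-++⁺ʳ xs ]′ ∘ ∈-ʳ++⁻ xs)
    (interval-snoc lo≤hi I)

  -- From depth 2 on, the next wall is mated with the head of the far side and cannot be passed; at
  -- depth 0 nothing is left to pass. At depth 1 the near side is the outward roll, which can also
  -- be entered: this is the extra `suc r` in `reversed`.
  corridor-gaps : ∀ r j d {e S} → a ≤ e → e + suc r ≡ a + b → Closed e S →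
    isEven (suc j + d) ≡ isEven e → r + 3 ≤ suc j + d →
    Counts (not (direction e)) (suc e) (S ʳ++ e ∷ corridor (suc j) (suc d)) (corridor (suc j) d) (crimped d r) →
    CountsBeyond e S (corridor (suc j) d) (corridor (suc j) (suc d)) (reversed d r)
  corridor-gaps r j 0 a≤e eq closed par r≤ child = last-gap (e<m a≤e eq) closed (λ ()) child
  corridor-gaps r 0 1 a≤e eq closed par r≤ child = contradiction (≤-trans (m≤n+m 3 r) r≤) λ { (s≤s (s≤s ())) }
  corridor-gaps r (suc i) 1 {e} {S} a≤e eq closed par r≤ child =
    let _ , _ , S≡ , tie = turned-tie {e} i i-par in
    next-gap (e<m a≤e eq) closed S≡ tie child
      (last-gap (e<m a≤e eq)
        (closed-++ closed (interval-closed (turned-interval i) (inj₁ refl) i-par))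
        (λ { refl → suc (suc i) , here (sym (+-identityʳ _)) , inj₁ (refl , i-par) })
        (next-V a≤e eq (resp-near (sym (trans (++-ʳ++ S) (spiral-reverse i _)))
          (winding-in r (suc i) (m≤n⇒m≤1+n a≤e) (suc-e+r≡m a≤e eq) i-par
            (s≤s (+-cancelʳ-≤ 3 r i (≤-trans r≤ (≤-reflexive (trans (+-comm (2 + i) 1) (+-comm 3 i))))))
            (∈-ʳ++⁺ʳ S (here refl)) (here refl)))))
    where
    i-par : isEven (suc i) ≡ isEven e
    i-par = trans (sym (isEven-2+ (suc i))) (trans (cong isEven (+-comm 1 (2 + i))) par)
  corridor-gaps r j (suc (suc d)) a≤e eq closed par r≤ child = last-gap (e<m a≤e eq) closed
    (λ { refl → suc j + suc d , here refl , inj₁ (+-suc (suc j) d , trans (sym (isEven-+2 (suc j) d)) par) })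
    child

  -- The mate of `lo` is `lo - 1`: the corridor wall right behind the run `lo ∷ B` or, at depth 0,
  -- the last face of the outward roll. So the next face coils up or passes that mate. In a corridor
  -- this makes the depth drop together with `r`, which preserves the bound.
  winding-crimped : ∀ r j d {lo e B B₀} → a ≤ suc e → suc e + r ≡ a + b →
    lo ∷ B ≡ B₀ ∷ʳ e → lo ≡ suc j + d → Interval lo (suc e) (lo ∷ B) → isEven lo ≡ isEven e →
    r + 3 ≤ suc j + d →
    CountsV (suc e) (lo ∷ B ++ corridor (suc j) (suc d)) (corridor (suc j) d) (crimped d r)
  winding-crimped zero j d a≤e eq B≡ lo≡ I par r≤ = complete-V eq
  winding-crimped (suc r) j zero {lo} {e} {B} {B₀} a≤e eq B≡ lo≡ I par r≤ with spiral-last j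
  ... | S₀ , S≡ = resp-near (++-identityʳ (lo ∷ B ++ spiral (suc j))) (start-V a≤e eq
    (next-gap (e<m a≤e eq) {S₀ = lo ∷ B ++ S₀} closed-[]
      (trans (cong (λ xs → lo ∷ B ++ xs) S≡) (sym (++-assoc (lo ∷ B) S₀ [ j ])))
      (inj₂ (inj₂ (lo≡1+j , isEven-pred j e (trans (cong isEven (sym lo≡1+j)) par))))
      (coil-back r a≤e eq (∈-++⁺ˡ (∈-++⁺ˡ e∈B)))
      (whole-gap (e<m a≤e eq) refl (next-V a≤e eq (resp-near (sym turned)
        (winding-capped r j (m≤n⇒m≤1+n a≤e) (suc-e+r≡m a≤e eq)
          (trans (sym turned-B) (ʳ++-defn (lo ∷ B)))
          (trans (cong isEven (sym lo≡1+j)) par)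
          (subst (suc j ∈_) turned-B (∈-ʳ++⁺ˡ {xs = lo ∷ B} (here (sym lo≡1+j))))
          r≤1+j))))))
    where
    lo≡1+j : lo ≡ suc j
    lo≡1+j = trans lo≡ (+-identityʳ (suc j))
    e∈B : e ∈ lo ∷ B
    e∈B = subst (e ∈_) (sym B≡) (∈-++⁺ʳ B₀ (here refl))
    turned-B : (lo ∷ B) ʳ++ [ suc e ] ≡ e ∷ (B₀ ʳ++ [ suc e ])
    turned-B = trans (cong (_ʳ++ [ suc e ]) B≡) (++-ʳ++ B₀)
    turned : (lo ∷ B ++ spiral (suc j)) ʳ++ [ suc e ] ≡ j ∷ spiral j ++ e ∷ (B₀ ʳ++ [ suc e ])
    turned = trans (++-ʳ++ (lo ∷ B)) (trans (reverse-spiral j _) (cong (λ xs → j ∷ spiral j ++ xs) turned-B))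
    r≤1+j : r ≤ suc j
    r≤1+j = ≤-trans (≤-trans (m≤m+n r 4) (≤-reflexive (+-suc r 3))) (≤-trans r≤ (≤-reflexive (+-identityʳ (suc j))))
  winding-crimped (suc r) j (suc d) {lo} {e} {B} {B₀} a≤e eq B≡ lo≡ I par r≤ =
    resp-near (cong (lo ∷_) (++-assoc B [ x ] (corridor (suc j) d))) (start-V a≤e eq
      (next-gap (e<m a≤e eq) {S₀ = lo ∷ B} closed-[] refl (inj₂ (inj₂ (lo≡1+x , x-par)))
        (coil-back r a≤e eq (∈-++⁺ˡ {xs = lo ∷ B ∷ʳ x} (∈-++⁺ˡ {xs = lo ∷ B} e∈B)))
        (corridor-gaps r j d a≤e eq S-closed x-par bound (next-V a≤e eq child))))
    where
    x = suc j + d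
    lo≡1+x : lo ≡ suc x
    lo≡1+x = trans lo≡ (+-suc (suc j) d)
    x-par : isEven x ≡ isEven (suc e)
    x-par = isEven-pred x e (trans (cong isEven (sym lo≡1+x)) par)
    e∈B : e ∈ lo ∷ B
    e∈B = subst (e ∈_) (sym B≡) (∈-++⁺ʳ B₀ (here refl))
    lo≤e : lo ≤ e
    lo≤e = proj₁ (proj₁ I e∈B)
    x<e : x < e
    x<e = subst (_≤ e) lo≡1+x lo≤e
    I′ : ∀ {hi xs} → Interval lo hi xs → Interval (suc x) hi xs
    I′ {hi} {xs} = subst (λ lo → Interval lo hi xs) lo≡1+x
    S = lo ∷ B ∷ʳ x
    S-closed : Closed (suc e) S
    S-closed = interval-closed
      (interval-resp (∈-∷ʳ⇄ (lo ∷ B)) (interval-cons (m<n⇒m<1+n x<e) (I′ I)))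
      (inj₂ x-par) refl
    bound : r + 3 ≤ x
    bound = s≤s⁻¹ (≤-trans r≤ (≤-reflexive (+-suc (suc j) d)))
    child : CountsV (suc (suc e)) (S ʳ++ suc e ∷ corridor (suc j) (suc d)) (corridor (suc j) d) (crimped d r)
    -- Reversal brings `x` to the front and `suc e` comes last, so the new run goes from `x` to
    -- `suc e`.
    child = resp-near
      (trans (cong (x ∷_) (ʳ++-append (lo ∷ B))) (sym (++-ʳ++ (lo ∷ B))))
      (winding-crimped r j d {B₀ = x ∷ reverse (lo ∷ B)} (m≤n⇒m≤1+n a≤e) (suc-e+r≡m a≤e eq)
        (cong (x ∷_) (ʳ++-defn (lo ∷ B))) refl
        (interval-cons (m<n⇒m<1+n (m<n⇒m<1+n x<e)) (I′ (ʳ++-interval (m≤n⇒m≤1+n lo≤e) I)))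
        x-par bound)

  -- The change of slope at face `a` exchanges the near and the far side of the corridor. No face
  -- has been passed yet, and the run for `winding-crimped` starts as `a` alone.
  reversing : ∀ r j d → b ≡ suc r → suc j + d ≡ a → r + 3 ≤ a →
    CountsV a (corridor (suc j) d) (corridor (suc j) (suc d)) (reversed d r)
  reversing r j d refl j+d≡a r≤ = start-V ≤-refl refl
    (corridor-gaps r j d ≤-refl refl closed-[] (cong isEven j+d≡a) (≤-trans r≤ (≤-reflexive (sym j+d≡a)))
      (next-V ≤-refl refl (winding-crimped r j d {B₀ = []} (n≤1+n a) (sym (+-suc a r)) refl (sym j+d≡a)
        interval-singleton refl (≤-trans r≤ (≤-reflexive (sym j+d≡a))))))

  -- Faces of slope M.

  module _ {e} (e<a : e < a) where
    start-M : ∀ {P Q n} → CountsBeyond e [] P Q n → CountsM e P Q n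
    start-M {P} {Q} {n} C = subst (λ d → Counts d e P Q n) (direction-M e<a) (counts-from-start C)

    next-M : ∀ {P Q n} → CountsM (suc e) P Q n → Counts (not (direction e)) (suc e) P Q n
    next-M {P} {Q} {n} C = subst (λ d → Counts (not d) (suc e) P Q n) (sym (direction-M e<a)) C

    e<a+b : e < a + b
    e<a+b = m≤n⇒m≤n+o b e<a

  module _ (r : ℕ) (b≡ : b ≡ suc r) (r≤ : r + 3 ≤ a) where
    -- Inside the corridor the nearest face always has its mate on the far side, so the remaining
    -- creases of slope M are forced.
    rolling-in : ∀ t j d {e} → e ≡ suc j + suc d → e + t ≡ a →
      CountsM e (corridor (suc j) (suc (suc d))) (corridor (suc j) (suc d)) (reversed (suc d + t) r)
    rolling-in zero j d {e} refl eq with trans (sym (+-identityʳ e)) eq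
    ... | refl = subst (λ n → CountsM e (corridor (suc j) (suc (suc d))) (corridor (suc j) (suc d)) (reversed n r)) (sym (+-identityʳ (suc d)))
      (counts-swap (reversing r j (suc d) b≡ refl r≤))
    rolling-in (suc t) j d {e} refl eq = start-M e<a (last-gap (e<a+b e<a) closed-[] (blocked d)
      (next-M e<a (subst (λ n → CountsM (suc e) (corridor (suc j) (3 + d)) (corridor (suc j) (2 + d)) (reversed n r)) (sym (+-suc (suc d) t))
        (rolling-in t j (suc d) (sym (+-suc (suc j) (suc d))) (trans (sym (+-suc e t)) eq)))))
      where
      e<a : e < a
      e<a = subst (e <_) eq (m<m+n e {suc t} (s≤s z≤n))
      blocked : ∀ d {h R} → corridor (suc j) (suc (suc d)) ≡ h ∷ R →
        ∃ λ y → y ∈ corridor (suc j) (suc d) × Mate (suc j + suc d) h y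
      blocked zero refl = j , proj₂ (spiral-interval (suc j)) z≤n ≤-refl
        , inj₂ (cong suc (+-identityʳ j) , sym (trans (cong isEven (+-comm (suc j) 1)) (isEven-2+ j)))
      blocked (suc d) refl = suc j + d , here refl
        , inj₂ (+-suc (suc j) d , sym (isEven-+2 (suc j) d))

    -- The near side is a roll whose end faces coincide or are mates. The next face therefore stops
    -- in front of it, which fixes the outward roll at `suc j` faces and starts the inward one, or
    -- wraps around everything.
    rolling-out : ∀ t j {e} → e ≡ suc j → e + t ≡ a → CountsM e (spiral (suc j)) [] (rolled t r)
    rolling-out zero j {e} refl eq with trans (sym (+-identityʳ e)) eq
    ... | refl = counts-swap (reversing r j 0 b≡ (+-identityʳ (suc j)) r≤)
    rolling-out (suc t) j {e} refl eq with ends j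
      where
      ends : ∀ j → ∃ λ h → ∃ λ S₁ → ∃ λ S₀ → ∃ λ y → spiral (suc j) ≡ h ∷ S₁ × h ∷ S₁ ≡ S₀ ∷ʳ y × (h ≡ y ⊎ Mate (suc j) h y)
      ends zero    = 0 , [] , [] , 0 , refl , refl , inj₁ refl
      ends (suc i) = i , _ , i ∷ spiral i , suc i , refl , refl , inj₂ (inj₁ (refl , sym (isEven-2+ i)))
    ... | h , S₁ , S₀ , y , spiral≡ , S≡ , tie =
      subst (λ P → CountsM e P [] (rolled (suc t) r)) (trans (++-identityʳ (h ∷ S₁)) (sym spiral≡))
        (start-M e<a (next-gap (e<a+b e<a) closed-[] S≡ tie
          (next-M e<a (subst₂ (λ P Q → CountsM (suc e) P Q (reversed (suc t) r))
            (cong [_] (+-identityʳ e)) (trans spiral≡ (sym (++-identityʳ (h ∷ S₁))))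
            (rolling-in t j 0 (+-comm 1 e) (trans (sym (+-suc e t)) eq))))
          (whole-gap (e<a+b e<a) refl (next-M e<a (subst (λ P → CountsM (suc e) P [] (rolled t r))
            (sym (trans (cong (_ʳ++ [ e ]) (sym spiral≡)) (reverse-spiral j [ e ])))
            (rolling-out t (suc j) refl (trans (sym (+-suc e t)) eq)))))))
      where
      e<a : e < a
      e<a = subst (e <_) eq (m<m+n e {suc t} (s≤s z≤n))

    -- The first crease leaves no choice, so the sum is governed by the other `a - 1` creases of
    -- slope M.
    c-rolled : ∀ t → suc t ≡ a → c (MᵃVᵇ a b) ≡ rolled t r
    c-rolled t refl = c-from-start (counts-from-start
      (last-gap (e<a+b (s≤s z≤n)) closed-[] (λ ()) (next-M (s≤s z≤n) (rolling-out t 0 refl refl))))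

-- Closed form of the recursions.

crimpedSum : ℕ → ℕ → ℕ
crimpedSum 0       r = crimped 0 r
crimpedSum (suc n) r = crimped (suc n) r + crimpedSum n r

-- `reversed` and `crimped` differ at depth 1 only, by `suc r`.
rolled-crimpedSum : ∀ n r → rolled (suc n) r ≡ crimpedSum (suc n) r + suc r
rolled-crimpedSum zero    r = regroup (crimped 1 r) (suc r) (crimped 0 r)
  where
  regroup : ∀ x y z → (x + y) + z ≡ (x + z) + y
  regroup = solve-∀
rolled-crimpedSum (suc n) r = trans (cong (crimped (2 + n) r +_) (rolled-crimpedSum n r))
  (sym (+-assoc (crimped (2 + n) r) _ _))

capped-formula : ∀ r → capped r ≡ suc (r + r)
capped-formula zero    = refl
capped-formula (suc r) = refl

-- The `n + 2` terms of positive depth unfold to `1 + reversed d r` with `d ≤ n + 1`. The increment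
-- is thus `(n + 2) + suc r + (2 + 2 * r)`, the last summand being `crimped 0 (suc r)`.
crimpedSum-suc : ∀ n r → crimpedSum (2 + n) (suc r) ≡ crimpedSum (suc n) r + (n + 3 * r + 5)
crimpedSum-suc zero    r rewrite capped-formula r = regroup (crimped 1 r) (crimped 0 r) r
  where
  regroup : ∀ x y r → suc (x + suc r) + (suc y + suc (suc (r + r))) ≡ (x + y) + (3 * r + 5)
  regroup = solve-∀
crimpedSum-suc (suc n) r = trans (cong (suc (crimped (2 + n) r) +_) (crimpedSum-suc n r))
  (regroup (crimped (2 + n) r) (crimpedSum (suc n) r) n (3 * r))
  where
  regroup : ∀ x y n s → suc x + (y + (n + s + 5)) ≡ (x + y) + (suc n + s + 5)
  regroup = solve-∀

crimpedSum-zero : ∀ n → crimpedSum n 0 ≡ suc n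
crimpedSum-zero zero    = refl
crimpedSum-zero (suc n) = cong suc (crimpedSum-zero n)

-- Induction on `r` with `t` fixed, since `crimpedSum-suc` lowers the depth bound and `r` together.
crimpedSum-formula : ∀ t r → crimpedSum (suc (t + r)) r ≡ (2 + t) * suc r + r + 2 * (r * r)
crimpedSum-formula t zero    = trans (crimpedSum-zero (suc (t + 0))) (base t)
  where
  base : ∀ t → suc (suc (t + 0)) ≡ (2 + t) * 1 + 0 + 2 * (0 * 0)
  base = solve-∀
crimpedSum-formula t (suc r) = trans (cong (λ n → crimpedSum (suc n) (suc r)) (+-suc t r))
  (trans (crimpedSum-suc (t + r) r) (trans (cong (_+ (t + r + 3 * r + 5)) (crimpedSum-formula t r)) (step t r)))
  where
  step : ∀ t r → ((2 + t) * suc r + r + 2 * (r * r)) + (t + r + 3 * r + 5)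
               ≡ (2 + t) * suc (suc r) + suc r + 2 * (suc r * suc r)
  step = solve-∀

rolled-formula : ∀ t r → let a = 2 + t + r ; b = suc r in rolled (suc (t + r)) r ≡ a * b + b * b ∸ b + 1
rolled-formula t r = trans (rolled-crimpedSum (t + r) r)
  (trans (cong (_+ suc r) (crimpedSum-formula t r))
  (trans (expand t r)
  -- `regroup` splits off a summand `suc r`, so the subtraction is not truncated.
  (cong (_+ 1) (sym (trans (cong (_∸ suc r) (regroup t r)) (m+n∸n≡m ((2 + t + r) * suc r + r * suc r) (suc r)))))))
  where
  expand : ∀ t r → ((2 + t) * suc r + r + 2 * (r * r)) + suc r ≡ ((2 + t + r) * suc r + r * suc r) + 1
  expand = solve-∀
  regroup : ∀ t r → (2 + t + r) * suc r + suc r * suc r ≡ ((2 + t + r) * suc r + r * suc r) + suc r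
  regroup = solve-∀

theorem3p1 : (a b : ℕ) → b + 1 < a → 4 < b →
    c (MᵃVᵇ a b) ≡ a * b + b * b ∸ b + 1
theorem3p1 a (suc r) b+1<a 4<b with m≤n⇒∃[o]m+o≡n b+1<a
-- `o` is the slack `a - b - 2`. As `b` is `suc r`, the bound `r + 3 ≤ a` is `b + 1 < a`, and `t` in
-- `rolled-formula` becomes `suc o`.
... | o , refl = trans
  (Spirals.c-rolled _ (suc r) r refl (≤-trans (≤-reflexive (r+3 r)) (m≤m+n _ o)) _ refl)
  (trans (cong (λ n → rolled n r) (shape r o)) (trans (rolled-formula (suc o) r) (cong (λ a → a * suc r + suc r * suc r ∸ suc r + 1) (sym (cong suc (shape r o))))))
  where
  r+3 : ∀ r → r + 3 ≡ suc (suc r + 1)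
  r+3 = solve-∀
  shape : ∀ r o → suc r + 1 + o ≡ suc (suc o + r)
  shape = solve-∀
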